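{- Assume the setup below. For every $\mathbf k\in\mathbb N^d$ with $|\mathbf k|>0$, $$\partial^{\mathbf k}H\Big|_{w=0}=\sum_{\substack{\mathbf i,\mathbf j\ne\mathbf 0\\ \mathbf i+\mathbf j=\mathbf k}}\ \sum_{\substack{\mathbf 0\ne\mathbf s\le\mathbf i\\ \mathbf 0\ne\mathbf t\le\mathbf j}}C(\mathbf i,\mathbf j)\,S^{\mathbf i}_{\mathbf s}S^{\mathbf j}_{\mathbf t}\,\mathbb E_x\big[A^{\mathbf s}(x)A^{\mathbf t}(x)\big],$$ where $C(\mathbf i,\mathbf j)=\prod\binom{i_u+j_u}{i_u}$, the product running over all $d$ coordinates $u$ of $\mathbb N^d$, and $\mathbb E_x$ is expectation with respect to $q$.
   Context: Fix integers $r\ge1$ and, for $1\le a\le r$, integers $n_a\ge1$ and $p_a\ge1$; put $d=\sum_{a=1}^r p_a$. An error syndrome is a tuple $\gamma=(\gamma_1,\dots,\gamma_r)$ of functions $\gamma_a:\{1,\dots,n_a\}\to\{0,1,\dots,p_a\}$. Its weight is $\mathrm{wt}(\gamma)=(s^a_b)_{1\le a\le r,\,1\le b\le p_a}\in\mathbb N^d$ with $s^a_b=|\gamma_a^{ -1}(b)|$. Multi-indices $\mathbf k=(k^a_b)\in\mathbb N^d$ are indexed the same way; write $\mathbf k^a=(k^a_1,\dots,k^a_{p_a})$, $|\mathbf k^a|=\sum_b k^a_b$, $|\mathbf k|=\sum_a|\mathbf k^a|$, and $\mathbf s\le\mathbf k$ means $s^a_b\le k^a_b$ for all $a,b$. Given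 a finite set $\mathcal Q$ and a function $\pi:\prod_{a=1}^r\{0,\dots,p_a\}^{n_a}\to\mathcal Q$, set $\mathrm{eval}(\pi,\gamma)=\pi(\gamma_1(1),\dots,\gamma_1(n_1),\dots,\gamma_r(1),\dots,\gamma_r(n_r))$ and, for $\tau\in\mathcal Q$, define the polynomial in variables $x^a_b$ ($1\le a\le r$, $0\le b\le p_a$) $$f^\tau_\pi=\sum_\gamma \delta_{\tau=\mathrm{eval}(\pi,\gamma)}\prod_{a=1}^r\prod_{c=1}^{n_a}x^a_{\gamma_a(c)}$$ (sum over all error syndromes). We regard it as a polynomial in $w=(w^a_b)_{1\le a\le r,\,1\le b\le p_a}$ via the substitution $x^a_0=1-\sum_{b=1}^{p_a}w^a_b$, $x^a_b=w^a_b$ for $b\ge1$; the point $w=0$ corresponds to all $x^a_0=1$ and all other $x^a_b=0$. Write $\partial^{\mathbf k}=\prod_{a,b}(\partial/\partial w^a_b)^{k^a_b}$. For $\mathbf s\le\mathbf k$, $$S^{\mathbf k}_{\mathbf s}=\prod_{a=1}^r\Big\{\delta_{n_a\ge|\mathbf k^a|}(-1)^{|\mathbf k^a|-|\mathbf s^a|}\frac{(n_a-|\mathbf s^a|)!}{(n_a-|\mathbf k^a|)!}\prod_{b=1}^{p_a}\frac{k^a_b!}{(k^a_b-s^a_b)!}\Big\},$$ interpreted as $0$ when some $n_a<|\mathbf k^a|$. Further let $I$ be a finite set, $q$ a probability distribution on $I$, $y:I\to\mathcal Q$ a function, and for each $x\in I$ let $\pi_x:\prod_a\{0,\dots,p_a\}^{n_a}\to\mathcal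 Q$ be a function with $\pi_x(0,\dots,0)=y(x)$. Put $g(x,w)=\sum_{\tau\ne y(x)}f^\tau_{\pi_x}(w)$, $H(w)=\sum_{x\in I}q(x)g(x,w)^2$, and $A^{\mathbf s}(x)=|\{\gamma:\mathrm{wt}(\gamma)=\mathbf s,\ \mathrm{eval}(\pi_x,\gamma)\ne y(x)\}|$. (In the paper, $\pi_x$ encodes the computation paths of a universal Turing machine simulating a fixed machine $M$ for $t$ steps on input $x$, $g(x,w)$ is the probability of an output error for the noisy code $w$ near the code of $M$, and $A^{\mathbf s}(x)$ counts weight-$\mathbf s$ error syndromes producing an output error.) -}

module Defs where

open import Algebra.Bundles using (CommutativeMonoid; CommutativeRing; Semiring)
import Algebra.Definitions.RawSemiring as RawSemiringOps
import Algebra.Properties.CommutativeSemigroup as CommutativeSemigroupProperties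
open import Data.Bool.Base using (if_then_else_)
open import Data.Fin.Base using (Fin; zero; suc)
import Data.Fin.Properties as Fin
open import Data.List.Base using (List; []; _∷_; allFin; cartesianProduct; cartesianProductWith; concatMap; filter; foldr; length; map; upTo)
open import Data.Nat.Base as ℕ using (ℕ; zero; suc; _∸_; _!)
open import Data.Nat.Combinatorics using (_C_)
open import Data.Nat.DivMod using (_/_)
open import Data.Nat.GeneralisedArithmetic using (iterate)
import Data.Nat.ListAction as ℕ
import Data.Nat.Properties as ℕ
open import Data.Product.Base using (∃; _×_; _,_)
import Data.Product.Properties as Product
open import Data.Unit.Base using (⊤; tt)
open import Data.Vec.Base as Vec using (Vec)
open import Function.Base using (_∘_)
open import Function.Bundles using (_↔_; Inverse)
open import Function.Properties.Inverse using (↔⇒↣)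
open import Level as Level using (Level; _⊔_)
open import Relation.Binary.Core using (Rel)
open import Relation.Binary.Definitions using (DecidableEquality)
open import Relation.Binary.PropositionalEquality.Core using (_≡_)
open import Relation.Binary.Structures using (IsPartialOrder)
open import Relation.Nullary.Decidable.Core using (Dec; does; ¬?; _×-dec_)
open import Relation.Nullary.Decidable using (via-injection)

------------------------------------------------------------------------
-- Scalars

-- The real numbers are an instance; the order need not be total, so this also
-- covers constructive versions of ℝ.
record OrderedCommutativeRing (c ℓ₁ ℓ₂ : Level) : Set (Level.suc (c ⊔ ℓ₁ ⊔ ℓ₂)) where
  infix 4 _≤_
  field
    commutativeRing : CommutativeRing c ℓ₁
  open CommutativeRing commutativeRing public
  field
    _≤_            : Rel Carrier ℓ₂
    isPartialOrder : IsPartialOrder _≈_ _≤_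
    +-monoʳ-≤      : ∀ x {y z} → y ≤ z → x + y ≤ x + z
    *-nonNeg       : ∀ {x y} → 0# ≤ x → 0# ≤ y → 0# ≤ x * y
    0≤1            : 0# ≤ 1#

module RingOps {c ℓ} (R : CommutativeRing c ℓ) where
  open CommutativeRing R
  open RawSemiringOps (Semiring.rawSemiring semiring) public using (_^_) renaming (_×_ to _·_)

  private variable
    A : Set

  ∑ : List A → (A → Carrier) → Carrier
  ∑ xs f = foldr (λ x → f x +_) 0# xs

  ∏ : List A → (A → Carrier) → Carrier
  ∏ xs f = foldr (λ x → f x *_) 1# xs

  fromℕ : ℕ → Carrier
  fromℕ m = m · 1#

  δ : ∀ {a} {P : Set a} → Dec P → Carrier
  δ P? = if does P? then 1# else 0#

------------------------------------------------------------------------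
-- Polynomials

-- R[V] is presented as the free commutative R-algebra on V: ring terms modulo
-- the congruence _≈ₚ_ generated by the ring laws and the ring structure of R.
module Polynomial {c ℓ} (R : CommutativeRing c ℓ) where
  open CommutativeRing R
    using (Carrier; _≈_; _+_; _*_; -_; 0#; 1#)
  private module R = CommutativeRing R

  infixl 6 _⊕_
  infixl 7 _⊗_
  infix  8 ⊖_
  infix  4 _≈ₚ_

  data Poly (V : Set) : Set c where
    con : Carrier → Poly V
    var : V → Poly V
    _⊕_ : Poly V → Poly V → Poly V
    _⊗_ : Poly V → Poly V → Poly V
    ⊖_  : Poly V → Poly V

  private variable
    V W : Set

  data _≈ₚ_ {V : Set} : Rel (Poly V) (c ⊔ ℓ) where
    refl  : ∀ {p} → p ≈ₚ p
    sym   : ∀ {p q} → p ≈ₚ q → q ≈ₚ p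
    trans : ∀ {p q s} → p ≈ₚ q → q ≈ₚ s → p ≈ₚ s

    con-cong : ∀ {x y} → x ≈ y → con x ≈ₚ con y
    con-+    : ∀ x y → con (x + y) ≈ₚ con x ⊕ con y
    con-*    : ∀ x y → con (x * y) ≈ₚ con x ⊗ con y

    ⊕-cong : ∀ {p p′ q q′} → p ≈ₚ p′ → q ≈ₚ q′ → p ⊕ q ≈ₚ p′ ⊕ q′
    ⊗-cong : ∀ {p p′ q q′} → p ≈ₚ p′ → q ≈ₚ q′ → p ⊗ q ≈ₚ p′ ⊗ q′
    ⊖-cong : ∀ {p p′} → p ≈ₚ p′ → ⊖ p ≈ₚ ⊖ p′

    ⊕-assoc     : ∀ p q s → (p ⊕ q) ⊕ s ≈ₚ p ⊕ (q ⊕ s)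
    ⊕-comm      : ∀ p q → p ⊕ q ≈ₚ q ⊕ p
    ⊕-identityˡ : ∀ p → con 0# ⊕ p ≈ₚ p
    ⊖-inverseˡ  : ∀ p → ⊖ p ⊕ p ≈ₚ con 0#
    ⊗-assoc     : ∀ p q s → (p ⊗ q) ⊗ s ≈ₚ p ⊗ (q ⊗ s)
    ⊗-comm      : ∀ p q → p ⊗ q ≈ₚ q ⊗ p
    ⊗-identityˡ : ∀ p → con 1# ⊗ p ≈ₚ p
    ⊗-distribˡ  : ∀ p q s → p ⊗ (q ⊕ s) ≈ₚ p ⊗ q ⊕ p ⊗ s

  polyRing : Set → CommutativeRing c (c ⊔ ℓ)
  polyRing V = record
    { Carrier = Poly V
    ; _≈_ = _≈ₚ_
    ; _+_ = _⊕_
    ; _*_ = _⊗_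
    ; -_  = ⊖_
    ; 0#  = con 0#
    ; 1#  = con 1#
    ; isCommutativeRing = record
      { isRing = record
        { +-isAbelianGroup = record
          { isGroup = record
            { isMonoid = record
              { isSemigroup = record
                { isMagma = record
                  { isEquivalence = record { refl = refl ; sym = sym ; trans = trans }
                  ; ∙-cong = ⊕-cong
                  }
                ; assoc = ⊕-assoc
                }
              ; identity = ⊕-identityˡ , λ p → trans (⊕-comm p _) (⊕-identityˡ p)
              }
            ; inverse = ⊖-inverseˡ , λ p → trans (⊕-comm p _) (⊖-inverseˡ p)
            ; ⁻¹-cong = ⊖-cong
            }
          ; comm = ⊕-comm
          }
        ; *-cong = ⊗-cong
        ; *-assoc = ⊗-assoc
        ; *-identity = ⊗-identityˡ , λ p → trans (⊗-comm p _) (⊗-identityˡ p)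
        ; distrib = ⊗-distribˡ , λ p q s →
            trans (⊗-comm _ p) (trans (⊗-distribˡ p q s) (⊕-cong (⊗-comm p q) (⊗-comm p s)))
        }
      ; *-comm = ⊗-comm
      }
    }

  ⟦_⟧ : Poly V → (V → Carrier) → Carrier
  ⟦ con x ⟧ ρ = x
  ⟦ var v ⟧ ρ = ρ v
  ⟦ p ⊕ q ⟧ ρ = ⟦ p ⟧ ρ + ⟦ q ⟧ ρ
  ⟦ p ⊗ q ⟧ ρ = ⟦ p ⟧ ρ * ⟦ q ⟧ ρ
  ⟦ ⊖ p ⟧   ρ = - ⟦ p ⟧ ρ

  ⟦⟧-cong : ∀ {p q : Poly V} → p ≈ₚ q → ∀ ρ → ⟦ p ⟧ ρ ≈ ⟦ q ⟧ ρ
  ⟦⟧-cong refl              ρ = R.refl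
  ⟦⟧-cong (sym e)           ρ = R.sym (⟦⟧-cong e ρ)
  ⟦⟧-cong (trans e e′)      ρ = R.trans (⟦⟧-cong e ρ) (⟦⟧-cong e′ ρ)
  ⟦⟧-cong (con-cong e)      ρ = e
  ⟦⟧-cong (con-+ x y)       ρ = R.refl
  ⟦⟧-cong (con-* x y)       ρ = R.refl
  ⟦⟧-cong (⊕-cong e e′)     ρ = R.+-cong (⟦⟧-cong e ρ) (⟦⟧-cong e′ ρ)
  ⟦⟧-cong (⊗-cong e e′)     ρ = R.*-cong (⟦⟧-cong e ρ) (⟦⟧-cong e′ ρ)
  ⟦⟧-cong (⊖-cong e)        ρ = R.-‿cong (⟦⟧-cong e ρ)
  ⟦⟧-cong (⊕-assoc p q s)   ρ = R.+-assoc _ _ _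
  ⟦⟧-cong (⊕-comm p q)      ρ = R.+-comm _ _
  ⟦⟧-cong (⊕-identityˡ p)   ρ = R.+-identityˡ _
  ⟦⟧-cong (⊖-inverseˡ p)    ρ = R.-‿inverseˡ _
  ⟦⟧-cong (⊗-assoc p q s)   ρ = R.*-assoc _ _ _
  ⟦⟧-cong (⊗-comm p q)      ρ = R.*-comm _ _
  ⟦⟧-cong (⊗-identityˡ p)   ρ = R.*-identityˡ _
  ⟦⟧-cong (⊗-distribˡ p q s) ρ = R.distribˡ _ _ _

  substitute : (V → Poly W) → Poly V → Poly W
  substitute σ (con x) = con x
  substitute σ (var v) = σ v
  substitute σ (p ⊕ q) = substitute σ p ⊕ substitute σ q
  substitute σ (p ⊗ q) = substitute σ p ⊗ substitute σ q
  substitute σ (⊖ p)   = ⊖ substitute σ p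

  substitute-cong : ∀ (σ : V → Poly W) {p q} → p ≈ₚ q → substitute σ p ≈ₚ substitute σ q
  substitute-cong σ refl               = refl
  substitute-cong σ (sym e)            = sym (substitute-cong σ e)
  substitute-cong σ (trans e e′)       = trans (substitute-cong σ e) (substitute-cong σ e′)
  substitute-cong σ (con-cong e)       = con-cong e
  substitute-cong σ (con-+ x y)        = con-+ x y
  substitute-cong σ (con-* x y)        = con-* x y
  substitute-cong σ (⊕-cong e e′)      = ⊕-cong (substitute-cong σ e) (substitute-cong σ e′)
  substitute-cong σ (⊗-cong e e′)      = ⊗-cong (substitute-cong σ e) (substitute-cong σ e′)
  substitute-cong σ (⊖-cong e)         = ⊖-cong (substitute-cong σ e)
  substitute-cong σ (⊕-assoc p q s)    = ⊕-assoc _ _ _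
  substitute-cong σ (⊕-comm p q)       = ⊕-comm _ _
  substitute-cong σ (⊕-identityˡ p)    = ⊕-identityˡ _
  substitute-cong σ (⊖-inverseˡ p)     = ⊖-inverseˡ _
  substitute-cong σ (⊗-assoc p q s)    = ⊗-assoc _ _ _
  substitute-cong σ (⊗-comm p q)       = ⊗-comm _ _
  substitute-cong σ (⊗-identityˡ p)    = ⊗-identityˡ _
  substitute-cong σ (⊗-distribˡ p q s) = ⊗-distribˡ _ _ _

  module _ {V : Set} (_≟_ : DecidableEquality V) where

    ∂ : V → Poly V → Poly V
    ∂ v (con x) = con 0#
    ∂ v (var u) = if does (v ≟ u) then con 1# else con 0#
    ∂ v (p ⊕ q) = ∂ v p ⊕ ∂ v q
    ∂ v (p ⊗ q) = ∂ v p ⊗ q ⊕ p ⊗ ∂ v q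
    ∂ v (⊖ p)   = ⊖ ∂ v p

    ∂-cong : ∀ v {p q} → p ≈ₚ q → ∂ v p ≈ₚ ∂ v q
    ∂-cong v refl               = refl
    ∂-cong v (sym e)            = sym (∂-cong v e)
    ∂-cong v (trans e e′)       = trans (∂-cong v e) (∂-cong v e′)
    ∂-cong v (con-cong e)       = refl
    ∂-cong v (con-+ x y)        = sym (⊕-identityˡ _)
    ∂-cong v (con-* x y)        = sym (trans (⊕-cong (P.zeroˡ _) (P.zeroʳ _)) (⊕-identityˡ _))
      where module P = CommutativeRing (polyRing V)
    ∂-cong v (⊕-cong e e′)      = ⊕-cong (∂-cong v e) (∂-cong v e′)
    ∂-cong v (⊗-cong e e′)      = ⊕-cong (⊗-cong (∂-cong v e) e′) (⊗-cong e (∂-cong v e′))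
    ∂-cong v (⊖-cong e)         = ⊖-cong (∂-cong v e)
    ∂-cong v (⊕-assoc p q s)    = ⊕-assoc _ _ _
    ∂-cong v (⊕-comm p q)       = ⊕-comm _ _
    ∂-cong v (⊕-identityˡ p)    = ⊕-identityˡ _
    ∂-cong v (⊖-inverseˡ p)     = ⊖-inverseˡ _
    ∂-cong v (⊗-assoc p q s)    =
      trans (⊕-cong (P.distribʳ _ _ _) refl)
      (trans (⊕-assoc _ _ _)
      (⊕-cong (⊗-assoc _ _ _)
        (trans (⊕-cong (⊗-assoc _ _ _) (⊗-assoc _ _ _)) (sym (⊗-distribˡ _ _ _)))))
      where module P = CommutativeRing (polyRing V)
    ∂-cong v (⊗-comm p q)       = trans (⊕-comm _ _) (⊕-cong (⊗-comm _ _) (⊗-comm _ _))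
    ∂-cong v (⊗-identityˡ p)    =
      trans (⊕-cong (P.zeroˡ _) (⊗-identityˡ _)) (⊕-identityˡ _)
      where module P = CommutativeRing (polyRing V)
    ∂-cong v (⊗-distribˡ p q s) =
      trans (⊕-cong (⊗-distribˡ _ _ _) (⊗-distribˡ _ _ _)) (interchange _ _ _ _)
      where
      module P = CommutativeRing (polyRing V)
      open CommutativeSemigroupProperties
        (CommutativeMonoid.commutativeSemigroup P.+-commutativeMonoid) using (interchange)

------------------------------------------------------------------------
-- Finite sets and enumerations

Finite : Set → Set
Finite A = ∃ λ m → A ↔ Fin m

elements : {A : Set} → Finite A → List A
elements (m , A↔Fin) = map (Inverse.from A↔Fin) (allFin m)

finite-≟ : {A : Set} → Finite A → DecidableEquality A
finite-≟ (m , A↔Fin) = via-injection (↔⇒↣ A↔Fin) Fin._≟_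

-- All choice functions, each listed once up to pointwise equality when the
-- given lists have no repetitions.
functions : ∀ {m} {F : Fin m → Set} → (∀ i → List (F i)) → List (∀ i → F i)
functions {zero}  xs = (λ ()) ∷ []
functions {suc m} xs = cartesianProductWith Fin.∀-cons (xs zero) (functions (xs ∘ suc))

-- Dependent tuples as data: unlike for functions, pointwise equal tuples are
-- propositionally equal, so every map out of this type is extensional.
Tuple : ∀ m → (Fin m → Set) → Set
Tuple zero    F = ⊤
Tuple (suc m) F = F zero × Tuple m (F ∘ suc)

tuple : ∀ {m} {F : Fin m → Set} → (∀ i → F i) → Tuple m F
tuple {zero}  f = tt
tuple {suc m} f = f zero , tuple (f ∘ suc)

------------------------------------------------------------------------
-- Syndromes and multi-indices

-- Indices a ∈ {1,…,r} and c ∈ {1,…,n_a} are elements of Fin r and Fin (n a).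
-- In {0,…,p_a} = Fin (suc (p a)), zero is 0 and suc b, for b : Fin (p a), ranges
-- over {1,…,p_a}.
module Syndromes {r : ℕ} (n p : Fin r → ℕ) where

  Syndrome : Set
  Syndrome = (a : Fin r) → Fin (n a) → Fin (suc (p a))

  syndromes : List Syndrome
  syndromes = functions λ a → functions λ c → allFin (suc (p a))

  Word : Set
  Word = Tuple r λ a → Vec (Fin (suc (p a))) (n a)

  eval : {Q : Set} → (Word → Q) → Syndrome → Q
  eval π γ = π (tuple λ a → Vec.tabulate (γ a))

  zeroWord : Word
  zeroWord = tuple λ a → Vec.replicate (n a) zero

  MultiIndex : Set
  MultiIndex = (a : Fin r) → Fin (p a) → ℕ

  wt : Syndrome → MultiIndex
  wt γ a b = length (filter (λ c → γ a c Fin.≟ suc b) (allFin (n a)))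

  Coord : Set
  Coord = ∃ λ a → Fin (p a)

  _≟ᶜ_ : DecidableEquality Coord
  _≟ᶜ_ = Product.≡-dec Fin._≟_ Fin._≟_

  coords : List Coord
  coords = concatMap (λ a → map (a ,_) (allFin (p a))) (allFin r)

  infix 4 _≐_ _≐?_
  _≐_ : MultiIndex → MultiIndex → Set
  k ≐ l = ∀ a b → k a b ≡ l a b

  _≐?_ : ∀ k l → Dec (k ≐ l)
  k ≐? l = Fin.all? λ a → Fin.all? λ b → k a b ℕ.≟ l a b

  𝟎 : MultiIndex
  𝟎 a b = 0

  infixl 6 _+ᵐ_
  _+ᵐ_ : MultiIndex → MultiIndex → MultiIndex
  (k +ᵐ l) a b = k a b ℕ.+ l a b

  ∣_∣ᵃ : ∀ {m} → (Fin m → ℕ) → ℕ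
  ∣_∣ᵃ {m} v = ℕ.sum (map v (allFin m))

  ∣_∣ : MultiIndex → ℕ
  ∣ k ∣ = ℕ.sum (map (λ a → ∣ k a ∣ᵃ) (allFin r))

  below : MultiIndex → List MultiIndex
  below k = functions λ a → functions λ b → upTo (suc (k a b))

  nonzeroBelow : MultiIndex → List MultiIndex
  nonzeroBelow k = filter (λ s → ¬? (s ≐? 𝟎)) (below k)

  -- Pairs (i , j) with i, j ≠ 0 and i + j = k.
  splittings : MultiIndex → List (MultiIndex × MultiIndex)
  splittings k =
    filter (λ (i , j) → i +ᵐ j ≐? k) (cartesianProduct (nonzeroBelow k) (nonzeroBelow k))

  -- Written Cf rather than C, which is the binomial coefficient n C k.
  Cf : MultiIndex → MultiIndex → ℕ
  Cf i j = ℕ.product (map (λ (a , b) → (i a b ℕ.+ j a b) C i a b) coords)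

------------------------------------------------------------------------
-- The polynomials f, g, H and the coefficients

module Noise {c ℓ} (R : CommutativeRing c ℓ) {r : ℕ} (n p : Fin r → ℕ) where
  open CommutativeRing R using (Carrier; _*_; -_; 0#; 1#)
  open Polynomial R
  open Syndromes n p
  open RingOps R

  XVar : Set
  XVar = ∃ λ a → Fin (suc (p a))

  WPoly : Set c
  WPoly = Poly Coord

  private
    module X = RingOps (polyRing XVar)
    module W = RingOps (polyRing Coord)

  ∂^ : MultiIndex → WPoly → WPoly
  ∂^ k P = foldr (λ (a , b) P′ → iterate (∂ _≟ᶜ_ (a , b)) P′ (k a b)) P coords

  at0 : WPoly → Carrier
  at0 P = ⟦ P ⟧ λ _ → 0#

  xToW : XVar → WPoly
  xToW (a , zero)  = con 1# ⊕ ⊖ W.∑ (allFin (p a)) λ b → var (a , b)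
  xToW (a , suc b) = var (a , b)

  -- Each quotient of factorials is exact when s ≤ k and |kᵃ| ≤ n a, the only case
  -- in which it is used.
  S : MultiIndex → MultiIndex → Carrier
  S k s = ∏ (allFin r) λ a →
    δ (∣ k a ∣ᵃ ℕ.≤? n a)
    * (- 1#) ^ (∣ k a ∣ᵃ ∸ ∣ s a ∣ᵃ)
    * fromℕ ((n a ∸ ∣ s a ∣ᵃ) !/! (n a ∸ ∣ k a ∣ᵃ))
    * ∏ (allFin (p a)) λ b → fromℕ (k a b !/! (k a b ∸ s a b))
    where
    infix 7 _!/!_
    _!/!_ : ℕ → ℕ → ℕ
    l !/! m = (l ! / m !) {{m ℕ.!≢0}}

  module _ {Q : Set} (finQ : Finite Q) where
    private
      _≟_ = finite-≟ finQ

    f : (Word → Q) → Q → Poly XVar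
    f π τ = X.∑ syndromes λ γ →
      X.δ (τ ≟ eval π γ) ⊗ X.∏ (allFin r) λ a → X.∏ (allFin (n a)) λ c → var (a , γ a c)

    fʷ : (Word → Q) → Q → WPoly
    fʷ π τ = substitute xToW (f π τ)

    module _ {I : Set} (y : I → Q) (π : I → Word → Q) where

      g : I → WPoly
      g x = W.∑ (filter (λ τ → ¬? (τ ≟ y x)) (elements finQ)) λ τ → fʷ (π x) τ

      A : MultiIndex → I → ℕ
      A s x = length (filter (λ γ → (wt γ ≐? s) ×-dec ¬? (eval (π x) γ ≟ y x)) syndromes)

      H : Finite I → (I → Carrier) → WPoly
      H finI q = W.∑ (elements finI) λ x → con (q x) ⊗ g x W.^ 2

module Probability {c ℓ₁ ℓ₂} (K : OrderedCommutativeRing c ℓ₁ ℓ₂) {I : Set} (finI : Finite I) where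
  open OrderedCommutativeRing K
  open RingOps commutativeRing

  record IsDistribution (q : I → Carrier) : Set (ℓ₁ ⊔ ℓ₂) where
    field
      nonNeg : ∀ x → 0# ≤ q x
      total  : ∑ (elements finI) q ≈ 1#

  𝔼 : (I → Carrier) → (I → Carrier) → Carrier
  𝔼 q h = ∑ (elements finI) λ x → q x * h x

{-# OPTIONS --safe #-}
module Submission where

-- Everything is expressed through the coefficients ∂₀ k P = (∂ᵏ P)(0).  By the
-- Leibniz rule ∂₀ k (g²) = ∑ C(i,j) ∂₀ i g ∂₀ j g over i + j = k, so it suffices to
-- know ∂₀ k g.  The monomial of a syndrome γ is a product over the blocks a of
-- polynomials in disjoint sets of variables, so ∂₀ k factors over the blocks; in
-- one block, adding the linear factors one at a time shows that the value depends
-- on γ only through s = wt γ, is 0 unless s ≤ k, and then is the a-th factor of S k s.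
-- Collecting syndromes by weight gives ∂₀ k g = ∑ S k s A s.  Since the zero
-- syndrome produces no error, s = 0 does not contribute and ∂₀ 0 g = 0, which
-- removes i = 0 and j = 0 from the Leibniz sum.

open import Defs
open import Algebra.Bundles using (CommutativeRing)
import Algebra.Properties.CommutativeSemigroup as CommutativeSemigroupProperties
import Algebra.Properties.Group as GroupProperties
import Algebra.Properties.Ring as RingProperties
import Algebra.Properties.Semiring.Mult as Mult
import Algebra.Solver.Ring.NaturalCoefficients.Default as SemiringSolver
open import Data.Bool.Base using (true; false; if_then_else_)
open import Data.Fin.Base using (Fin; zero; suc)
import Data.Fin.Properties as Fin
open import Data.List.Base using (List; []; _∷_; _++_; allFin; applyUpTo; cartesianProductWith; concatMap; filter; foldr; length; map; tabulate; upTo; cartesianProduct)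
import Data.List.Properties as List
open import Data.Nat.Base as ℕ using (ℕ; zero; suc; _∸_; pred; _!; _≤_; _<_)
open import Data.Nat.Combinatorics using (_C_; nCk+nC[k+1]≡[n+1]C[k+1]; k>n⇒nCk≡0)
open import Data.Nat.Combinatorics.Base using (_P′_)
open import Data.Nat.Combinatorics.Specification using (nP′k≡n!/[n∸k]!; nP′k≡n[n∸1P′k∸1])
open import Data.Nat.DivMod using (_/_)
open import Data.Nat.GeneralisedArithmetic using (iterate)
import Data.Nat.ListAction as ℕ
import Data.Nat.ListAction.Properties as ℕ
import Data.Nat.Properties as ℕ
open import Data.Product.Base using (_,_; proj₁)
open import Data.Sum.Base using (inj₁; inj₂)
import Data.Vec.Base as Vec
open import Data.Vec.Functional using (updateAt)
open import Data.Vec.Functional.Properties using (updateAt-updates; updateAt-minimal)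
import Data.Vec.Properties as Vec
open import Function.Base using (_∘_; id)
open import Function.Bundles using (Inverse)
open import Function.Definitions using (Injective)
open import Level using (_⊔_)
open import Relation.Binary.Definitions using (DecidableEquality)
open import Relation.Binary.PropositionalEquality.Core as ≡ using (_≡_; _≢_; _≗_)
open import Relation.Binary.PropositionalEquality.Properties using (module ≡-Reasoning)
import Relation.Binary.Reasoning.Setoid as SetoidReasoning
open import Relation.Nullary.Decidable using (Dec; yes; no; ¬?; _×-dec_; does; dec-true; dec-false; decidable-stable)
open import Relation.Nullary.Negation.Core using (¬_; contradiction)

-- The formula for `S` cannot be carried through the induction over linear factors: its quotients of
-- factorials are exact only for s ≤ k and |kᵃ| ≤ n a, and peeling off a factor can leave this
-- range. The induction therefore uses `Φ`, built from the falling factorials `_P′_`, which are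
-- total and vanish by themselves out of range. Adding a factor 1 - ∑ w_b then amounts to the
-- finite-difference rule for falling factorials, and `Φ` is exchanged for `S` only afterwards, in
-- `Φ≈Sᵃ`. In an arbitrary commutative ring one cannot divide by k!, so the argument works with
-- derivatives instead of Taylor coefficients; the integer identities are proved in ℕ and
-- transported by `fromℕ`. Multi-indices and syndromes are functions, compared only pointwise. Sums
-- over them run over lists, side conditions become factors `δ`, and a term can be evaluated at an
-- equal multi-index only once it is known to respect `≐`.

foldr-tabulate : ∀ {A B : Set} {c} {C : Set c} (f : B → C → C) (z : C) (h : A → B) {m} (u : Fin m → A) →
  foldr f z (tabulate (h ∘ u)) ≡ foldr (f ∘ h) z (tabulate u)
foldr-tabulate f z h {zero}  u = ≡.refl
foldr-tabulate f z h {suc m} u = ≡.cong (f (h (u zero))) (foldr-tabulate f z h (u ∘ suc))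

-- The tail of `allFin (suc m)` is `tabulate suc`, which is not definitionally `map suc (allFin m)`.
-- The inductions over blocks, coordinates and positions pass through this conversion.
foldr-allFin-suc : ∀ {c} {C : Set c} {m} (f : Fin (suc m) → C → C) (z : C) →
  foldr f z (allFin (suc m)) ≡ f zero (foldr (f ∘ suc) z (allFin m))
foldr-allFin-suc f z = ≡.cong (f zero) (foldr-tabulate f z suc id)

foldr-upTo-suc : ∀ {c} {C : Set c} (f : ℕ → C → C) (z : C) n →
  foldr f z (upTo (suc n)) ≡ f zero (foldr (f ∘ suc) z (upTo n))
foldr-upTo-suc {C = C} f z n = ≡.cong (f zero) (go f suc id n)
  where
  go : (f : ℕ → C → C) (h u : ℕ → ℕ) (n : ℕ) →
    foldr f z (applyUpTo (h ∘ u) n) ≡ foldr (f ∘ h) z (applyUpTo u n)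
  go f h u zero    = ≡.refl
  go f h u (suc n) = ≡.cong (f (h (u zero))) (go f h (u ∘ suc) n)

-- `sumFin v` unfolds to the same term as `∣ v ∣ᵃ`, so the factors of `S` can be handled without
-- conversion.
sumFin prodFin : ∀ {m} → (Fin m → ℕ) → ℕ
sumFin  {m} v = ℕ.sum (map v (allFin m))
prodFin {m} v = ℕ.product (map v (allFin m))

sumFin-suc : ∀ {m} (v : Fin (suc m) → ℕ) → sumFin v ≡ v zero ℕ.+ sumFin (v ∘ suc)
sumFin-suc {m} v = ≡.trans (List.foldr-map ℕ._+_ v 0 (allFin (suc m)))
  (≡.trans (foldr-allFin-suc (λ i → v i ℕ.+_) 0)
    (≡.cong (v zero ℕ.+_) (≡.sym (List.foldr-map ℕ._+_ (v ∘ suc) 0 (allFin m)))))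

prodFin-suc : ∀ {m} (v : Fin (suc m) → ℕ) → prodFin v ≡ v zero ℕ.* prodFin (v ∘ suc)
prodFin-suc {m} v = ≡.trans (List.foldr-map ℕ._*_ v 1 (allFin (suc m)))
  (≡.trans (foldr-allFin-suc (λ i → v i ℕ.*_) 1)
    (≡.cong (v zero ℕ.*_) (≡.sym (List.foldr-map ℕ._*_ (v ∘ suc) 1 (allFin m)))))

-- Finite sums, products and indicator factors in a commutative ring.

module FiniteSums {c ℓ} (R : CommutativeRing c ℓ) where
  open CommutativeRing R hiding (zero)
  open RingOps R
  open SetoidReasoning setoid
  open CommutativeSemigroupProperties +-commutativeSemigroup using () renaming (interchange to +-interchange)
  open CommutativeSemigroupProperties *-commutativeSemigroup using () renaming (interchange to *-interchange)
  open Mult semiring using (×1-homo-*; ×-homo-+)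

  private variable
    A B C : Set

  ∑-cong : ∀ (xs : List A) {f g : A → Carrier} → (∀ x → f x ≈ g x) → ∑ xs f ≈ ∑ xs g
  ∑-cong []       f≈g = refl
  ∑-cong (x ∷ xs) f≈g = +-cong (f≈g x) (∑-cong xs f≈g)

  ∑-zero : ∀ (xs : List A) {f : A → Carrier} → (∀ x → f x ≈ 0#) → ∑ xs f ≈ 0#
  ∑-zero []       f≈0 = refl
  ∑-zero (x ∷ xs) f≈0 = trans (+-cong (f≈0 x) (∑-zero xs f≈0)) (+-identityˡ 0#)

  ∑-+ : ∀ (xs : List A) {f g : A → Carrier} → ∑ xs (λ x → f x + g x) ≈ ∑ xs f + ∑ xs g
  ∑-+ []       = sym (+-identityˡ 0#)
  ∑-+ (x ∷ xs) = trans (+-congˡ (∑-+ xs)) (+-interchange _ _ _ _)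

  ∑-*ˡ : ∀ a (xs : List A) {f : A → Carrier} → a * ∑ xs f ≈ ∑ xs (λ x → a * f x)
  ∑-*ˡ a []       = zeroʳ a
  ∑-*ˡ a (x ∷ xs) = trans (distribˡ a _ _) (+-congˡ (∑-*ˡ a xs))

  ∑-*ʳ : ∀ (xs : List A) a {f : A → Carrier} → ∑ xs f * a ≈ ∑ xs (λ x → f x * a)
  ∑-*ʳ []       a = zeroˡ a
  ∑-*ʳ (x ∷ xs) a = trans (distribʳ a _ _) (+-congˡ (∑-*ʳ xs a))

  ∑-swap : ∀ (xs : List A) (ys : List B) {f : A → B → Carrier} →
    ∑ xs (λ x → ∑ ys (f x)) ≈ ∑ ys (λ y → ∑ xs (λ x → f x y))
  ∑-swap []       ys = sym (∑-zero ys (λ _ → refl))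
  ∑-swap (x ∷ xs) ys = trans (+-congˡ (∑-swap xs ys)) (sym (∑-+ ys))

  ∑-++ : ∀ (xs ys : List A) {f : A → Carrier} → ∑ (xs ++ ys) f ≈ ∑ xs f + ∑ ys f
  ∑-++ []       ys = sym (+-identityˡ _)
  ∑-++ (x ∷ xs) ys = trans (+-congˡ (∑-++ xs ys)) (sym (+-assoc _ _ _))

  ∑-map : ∀ (h : A → B) xs {f : B → Carrier} → ∑ (map h xs) f ≈ ∑ xs (f ∘ h)
  ∑-map h xs {f} = reflexive (List.foldr-map (λ x → f x +_) h 0# xs)

  ∑-cartesianProductWith : ∀ (h : A → B → C) xs ys {f : C → Carrier} →
    ∑ (cartesianProductWith h xs ys) f ≈ ∑ xs λ x → ∑ ys λ y → f (h x y)
  ∑-cartesianProductWith h []       ys = refl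
  ∑-cartesianProductWith h (x ∷ xs) ys =
    trans (∑-++ (map (h x) ys) _) (+-cong (∑-map (h x) ys) (∑-cartesianProductWith h xs ys))

  ∑-allFin-suc : ∀ {m} (f : Fin (suc m) → Carrier) → ∑ (allFin (suc m)) f ≈ f zero + ∑ (allFin m) (f ∘ suc)
  ∑-allFin-suc f = reflexive (foldr-allFin-suc (λ i → f i +_) 0#)

  ∑-upTo-suc : ∀ n (f : ℕ → Carrier) → ∑ (upTo (suc n)) f ≈ f zero + ∑ (upTo n) (f ∘ suc)
  ∑-upTo-suc n f = reflexive (foldr-upTo-suc (λ i → f i +_) 0# n)

  ∑-upTo-cong : ∀ n {f g : ℕ → Carrier} → (∀ i → i ℕ.< n → f i ≈ g i) → ∑ (upTo n) f ≈ ∑ (upTo n) g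
  ∑-upTo-cong zero            f≈g = refl
  ∑-upTo-cong (suc n) {f} {g} f≈g = begin
    ∑ (upTo (suc n)) f            ≈⟨ ∑-upTo-suc n f ⟩
    f 0 + ∑ (upTo n) (f ∘ suc)    ≈⟨ +-cong (f≈g 0 ℕ.z<s) (∑-upTo-cong n (λ i i<n → f≈g (suc i) (ℕ.s<s i<n))) ⟩
    g 0 + ∑ (upTo n) (g ∘ suc)    ≈⟨ ∑-upTo-suc n g ⟨
    ∑ (upTo (suc n)) g            ∎

  ∑-upTo-last : ∀ n (f : ℕ → Carrier) → ∑ (upTo (suc n)) f ≈ ∑ (upTo n) f + f n
  ∑-upTo-last zero    f = +-comm _ _
  ∑-upTo-last (suc n) f = begin
    ∑ (upTo (2 ℕ.+ n)) f                        ≈⟨ ∑-upTo-suc (suc n) f ⟩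
    f 0 + ∑ (upTo (suc n)) (f ∘ suc)            ≈⟨ +-congˡ (∑-upTo-last n (f ∘ suc)) ⟩
    f 0 + (∑ (upTo n) (f ∘ suc) + f (suc n))    ≈⟨ +-assoc _ _ _ ⟨
    (f 0 + ∑ (upTo n) (f ∘ suc)) + f (suc n)    ≈⟨ +-congʳ (∑-upTo-suc n f) ⟨
    ∑ (upTo (suc n)) f + f (suc n)              ∎

  ∏-cong : ∀ (xs : List A) {f g : A → Carrier} → (∀ x → f x ≈ g x) → ∏ xs f ≈ ∏ xs g
  ∏-cong []       f≈g = refl
  ∏-cong (x ∷ xs) f≈g = *-cong (f≈g x) (∏-cong xs f≈g)

  ∏-1 : ∀ (xs : List A) → ∏ xs (λ _ → 1#) ≈ 1#
  ∏-1 []       = refl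
  ∏-1 (x ∷ xs) = trans (*-identityˡ _) (∏-1 xs)

  ∏-* : ∀ (xs : List A) {f g : A → Carrier} → ∏ xs (λ x → f x * g x) ≈ ∏ xs f * ∏ xs g
  ∏-* []       = sym (*-identityˡ 1#)
  ∏-* (x ∷ xs) = trans (*-congˡ (∏-* xs)) (*-interchange _ _ _ _)

  ∏-allFin-suc : ∀ {m} (f : Fin (suc m) → Carrier) → ∏ (allFin (suc m)) f ≈ f zero * ∏ (allFin m) (f ∘ suc)
  ∏-allFin-suc f = reflexive (foldr-allFin-suc (λ i → f i *_) 1#)

  fromℕ-+ : ∀ m n → fromℕ (m ℕ.+ n) ≈ fromℕ m + fromℕ n
  fromℕ-+ = ×-homo-+ 1#

  fromℕ-* : ∀ m n → fromℕ (m ℕ.* n) ≈ fromℕ m * fromℕ n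
  fromℕ-* = ×1-homo-*

  ∑-fromℕ : ∀ {m} (v : Fin m → ℕ) → ∑ (allFin m) (fromℕ ∘ v) ≈ fromℕ (sumFin v)
  ∑-fromℕ {zero}  v = refl
  ∑-fromℕ {suc m} v = begin
    ∑ (allFin (suc m)) (fromℕ ∘ v)                     ≈⟨ ∑-allFin-suc (fromℕ ∘ v) ⟩
    fromℕ (v zero) + ∑ (allFin m) (fromℕ ∘ v ∘ suc)    ≈⟨ +-congˡ (∑-fromℕ (v ∘ suc)) ⟩
    fromℕ (v zero) + fromℕ (sumFin (v ∘ suc))          ≈⟨ fromℕ-+ (v zero) _ ⟨
    fromℕ (v zero ℕ.+ sumFin (v ∘ suc))                ≡⟨ ≡.cong fromℕ (sumFin-suc v) ⟨
    fromℕ (sumFin v)                                   ∎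

  fromℕ-prodFin : ∀ {m} (v : Fin m → ℕ) → fromℕ (prodFin v) ≈ ∏ (allFin m) (fromℕ ∘ v)
  fromℕ-prodFin {zero}  v = +-identityʳ 1#
  fromℕ-prodFin {suc m} v = begin
    fromℕ (prodFin v)                                  ≡⟨ ≡.cong fromℕ (prodFin-suc v) ⟩
    fromℕ (v zero ℕ.* prodFin (v ∘ suc))               ≈⟨ fromℕ-* (v zero) _ ⟩
    fromℕ (v zero) * fromℕ (prodFin (v ∘ suc))         ≈⟨ *-congˡ (fromℕ-prodFin (v ∘ suc)) ⟩
    fromℕ (v zero) * ∏ (allFin m) (fromℕ ∘ v ∘ suc)    ≈⟨ ∏-allFin-suc (fromℕ ∘ v) ⟨
    ∏ (allFin (suc m)) (fromℕ ∘ v)                     ∎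

  module _ {p} {P : Set p} where

    δ-yes : (P? : Dec P) → P → δ P? ≈ 1#
    δ-yes (yes _) _ = refl
    δ-yes (no ¬P) p = contradiction p ¬P

    δ-no : (P? : Dec P) → ¬ P → δ P? ≈ 0#
    δ-no (yes p) ¬P = contradiction p ¬P
    δ-no (no _)  _  = refl

    -- Under a sum, a side condition survives only as a factor `δ`; this recovers it as a hypothesis
    -- for rewriting the other factor.
    δ-*-congˡ : (P? : Dec P) {x y : Carrier} → (P → x ≈ y) → δ P? * x ≈ δ P? * y
    δ-*-congˡ (yes p) x≈y = *-congˡ (x≈y p)
    δ-*-congˡ (no _)  x≈y = trans (zeroˡ _) (sym (zeroˡ _))

    -- Used from right to left, it restricts a sum to a condition outside which the summand is zero.
    δ-*-absorb : (P? : Dec P) {x : Carrier} → (¬ P → x ≈ 0#) → δ P? * x ≈ x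
    δ-*-absorb (yes _) x≈0 = *-identityˡ _
    δ-*-absorb (no ¬P) x≈0 = trans (zeroˡ _) (sym (x≈0 ¬P))

  δ-cong : ∀ {p q} {P : Set p} {Q : Set q} (P? : Dec P) (Q? : Dec Q) → (P → Q) → (Q → P) → δ P? ≈ δ Q?
  δ-cong (yes p) Q? P→Q Q→P = sym (δ-yes Q? (P→Q p))
  δ-cong (no ¬P) Q? P→Q Q→P = sym (δ-no Q? (¬P ∘ Q→P))

  δ-× : ∀ {p q} {P : Set p} {Q : Set q} (P? : Dec P) (Q? : Dec Q) → δ (P? ×-dec Q?) ≈ δ P? * δ Q?
  δ-× (yes _) (yes _) = sym (*-identityˡ _)
  δ-× (yes _) (no _)  = sym (*-identityˡ _)
  δ-× (no _)  _       = sym (zeroˡ _)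

  δ-all? : ∀ {m p} {P : Fin m → Set p} (P? : ∀ i → Dec (P i)) → δ (Fin.all? P?) ≈ ∏ (allFin m) (δ ∘ P?)
  δ-all? {zero}  P? = refl
  δ-all? {suc m} P? = begin
    δ (Fin.all? P?)                              ≈⟨ δ-cong (Fin.all? P?) (P? zero ×-dec Fin.all? (P? ∘ suc)) (λ f → f zero , f ∘ suc) (λ (p , f) → Fin.∀-cons p f) ⟩
    δ (P? zero ×-dec Fin.all? (P? ∘ suc))        ≈⟨ δ-× (P? zero) (Fin.all? (P? ∘ suc)) ⟩
    δ (P? zero) * δ (Fin.all? (P? ∘ suc))        ≈⟨ *-congˡ (δ-all? (P? ∘ suc)) ⟩
    δ (P? zero) * ∏ (allFin m) (δ ∘ P? ∘ suc)    ≈⟨ ∏-allFin-suc (δ ∘ P?) ⟨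
    ∏ (allFin (suc m)) (δ ∘ P?)                  ∎

  ∑-filter : ∀ {p} {P : A → Set p} (P? : ∀ x → Dec (P x)) xs {f : A → Carrier} →
    ∑ (filter P? xs) f ≈ ∑ xs (λ x → δ (P? x) * f x)
  ∑-filter P? []       = refl
  ∑-filter P? (x ∷ xs) with P? x
  ... | yes _ = +-cong (sym (*-identityˡ _)) (∑-filter P? xs)
  ... | no _  = trans (∑-filter P? xs) (sym (trans (+-congʳ (zeroˡ _)) (+-identityˡ _)))

  fromℕ-length-filter : ∀ {p} {P : A → Set p} (P? : ∀ x → Dec (P x)) xs →
    fromℕ (length (filter P? xs)) ≈ ∑ xs (δ ∘ P?)
  fromℕ-length-filter P? []       = refl
  fromℕ-length-filter P? (x ∷ xs) with P? x
  ... | yes _ = +-congˡ (fromℕ-length-filter P? xs)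
  ... | no _  = trans (fromℕ-length-filter P? xs) (sym (+-identityˡ _))

  ∑-functions-suc : ∀ {m} {F : Fin (suc m) → Set} (xs : ∀ i → List (F i)) {f : (∀ i → F i) → Carrier} →
    ∑ (functions xs) f ≈ ∑ (xs zero) λ x → ∑ (functions (xs ∘ suc)) λ g → f (Fin.∀-cons x g)
  ∑-functions-suc {F = F} xs {f} = ∑-cartesianProductWith (Fin.∀-cons {P = F}) (xs zero) (functions (xs ∘ suc)) {f}

  -- The distributive law: expanding a product of sums chooses one term from each factor. It reduces
  -- counting in a box of multi-indices to counting in intervals.
  ∑-functions-∏ : ∀ {m} {F : Fin m → Set} (xs : ∀ i → List (F i)) (h : ∀ i → F i → Carrier) →
    ∑ (functions xs) (λ f → ∏ (allFin m) λ i → h i (f i)) ≈ ∏ (allFin m) λ i → ∑ (xs i) (h i)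
  ∑-functions-∏ {zero}  xs h = +-identityʳ 1#
  ∑-functions-∏ {suc m} xs h = begin
    ∑ (functions xs) (λ f → ∏ (allFin (suc m)) λ i → h i (f i))
      ≈⟨ ∑-cong (functions xs) (λ f → ∏-allFin-suc (λ i → h i (f i))) ⟩
    ∑ (functions xs) (λ f → h zero (f zero) * ∏ (allFin m) λ i → h (suc i) (f (suc i)))
      ≈⟨ ∑-functions-suc xs ⟩
    ∑ (xs zero) (λ x → ∑ (functions (xs ∘ suc)) λ f → h zero x * ∏ (allFin m) λ i → h (suc i) (f i))
      ≈⟨ ∑-cong (xs zero) (λ x → sym (∑-*ˡ (h zero x) (functions (xs ∘ suc)))) ⟩
    ∑ (xs zero) (λ x → h zero x * ∑ (functions (xs ∘ suc)) λ f → ∏ (allFin m) λ i → h (suc i) (f i))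
      ≈⟨ sym (∑-*ʳ (xs zero) _) ⟩
    ∑ (xs zero) (h zero) * ∑ (functions (xs ∘ suc)) (λ f → ∏ (allFin m) λ i → h (suc i) (f i))
      ≈⟨ *-congˡ (∑-functions-∏ (xs ∘ suc) (h ∘ suc)) ⟩
    ∑ (xs zero) (h zero) * ∏ (allFin m) (λ i → ∑ (xs (suc i)) (h (suc i)))
      ≈⟨ ∏-allFin-suc (λ i → ∑ (xs i) (h i)) ⟨
    ∏ (allFin (suc m)) (λ i → ∑ (xs i) (h i)) ∎

  ∑-upTo-δ : ∀ n t → ∑ (upTo n) (λ i → δ (t ℕ.≟ i)) ≈ δ (t ℕ.<? n)
  ∑-upTo-δ zero    t = sym (δ-no (t ℕ.<? 0) (λ ()))
  ∑-upTo-δ (suc n) zero = begin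
    ∑ (upTo (suc n)) (λ i → δ (0 ℕ.≟ i))       ≈⟨ ∑-upTo-suc n _ ⟩
    1# + ∑ (upTo n) (λ i → δ (0 ℕ.≟ suc i))    ≈⟨ +-congˡ (∑-zero (upTo n) (λ _ → refl)) ⟩
    1# + 0#                                    ≈⟨ +-identityʳ 1# ⟩
    1#                                         ≈⟨ δ-yes (0 ℕ.<? suc n) ℕ.z<s ⟨
    δ (0 ℕ.<? suc n)                           ∎
  ∑-upTo-δ (suc n) (suc t) = begin
    ∑ (upTo (suc n)) (λ i → δ (suc t ℕ.≟ i))       ≈⟨ ∑-upTo-suc n _ ⟩
    0# + ∑ (upTo n) (λ i → δ (suc t ℕ.≟ suc i))    ≈⟨ +-identityˡ _ ⟩
    ∑ (upTo n) (λ i → δ (suc t ℕ.≟ suc i))         ≈⟨ ∑-cong (upTo n) (λ i → δ-cong (suc t ℕ.≟ suc i) (t ℕ.≟ i) ℕ.suc-injective (≡.cong suc)) ⟩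
    ∑ (upTo n) (λ i → δ (t ℕ.≟ i))                 ≈⟨ ∑-upTo-δ n t ⟩
    δ (t ℕ.<? n)                                   ≈⟨ δ-cong (t ℕ.<? n) (suc t ℕ.<? suc n) ℕ.s<s ℕ.s<s⁻¹ ⟩
    δ (suc t ℕ.<? suc n)                           ∎

  ∑-allFin-δ : ∀ {m} (t : Fin m) → ∑ (allFin m) (λ i → δ (t Fin.≟ i)) ≈ 1#
  ∑-allFin-δ {suc m} zero = begin
    ∑ (allFin (suc m)) (λ i → δ (zero Fin.≟ i))      ≈⟨ ∑-allFin-suc {m} (λ i → δ (zero Fin.≟ i)) ⟩
    1# + ∑ (allFin m) (λ i → δ (zero Fin.≟ suc i))   ≈⟨ +-congˡ (∑-zero (allFin m) (λ _ → refl)) ⟩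
    1# + 0#                                          ≈⟨ +-identityʳ 1# ⟩
    1#                                               ∎
  ∑-allFin-δ {suc m} (suc t) = begin
    ∑ (allFin (suc m)) (λ i → δ (suc t Fin.≟ i))       ≈⟨ ∑-allFin-suc {m} (λ i → δ (suc t Fin.≟ i)) ⟩
    0# + ∑ (allFin m) (λ i → δ (suc t Fin.≟ suc i))    ≈⟨ +-identityˡ _ ⟩
    ∑ (allFin m) (λ i → δ (suc t Fin.≟ suc i))         ≈⟨ ∑-cong (allFin m) (λ i → δ-cong (suc t Fin.≟ suc i) (t Fin.≟ i) Fin.suc-injective (≡.cong suc)) ⟩
    ∑ (allFin m) (λ i → δ (t Fin.≟ i))                 ≈⟨ ∑-allFin-δ t ⟩
    1#                                                 ∎

-- Partial derivatives are not multiplicative, evaluation at a point is; what these maps and their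
-- composites share is additivity, and this suffices to pass through sums, integer multiples and
-- negation.
record Additive {a ℓ b ℓ′} (R : CommutativeRing a ℓ) (S : CommutativeRing b ℓ′)
  (E : CommutativeRing.Carrier R → CommutativeRing.Carrier S) : Set (a ⊔ b ⊔ ℓ ⊔ ℓ′) where
  private
    module R = CommutativeRing R
    module S = CommutativeRing S
    module Rₒ = RingOps R
    module Sₒ = RingOps S
  field
    cong   : ∀ {x y} → x R.≈ y → E x S.≈ E y
    +-homo : ∀ x y → E (x R.+ y) S.≈ E x S.+ E y
    0-homo : E R.0# S.≈ S.0#

  ∑-homo : ∀ {A : Set} (xs : List A) {f} → E (Rₒ.∑ xs f) S.≈ Sₒ.∑ xs (E ∘ f)
  ∑-homo []       = 0-homo
  ∑-homo (x ∷ xs) = S.trans (+-homo _ _) (S.+-congˡ (∑-homo xs))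

  ·-homo : ∀ n x → E (n Rₒ.· x) S.≈ n Sₒ.· E x
  ·-homo zero    x = 0-homo
  ·-homo (suc n) x = S.trans (+-homo _ _) (S.+-congˡ (·-homo n x))

  -‿homo : ∀ x → E (R.- x) S.≈ S.- E x
  -‿homo x = inverseˡ-unique (E (R.- x)) (E x) (S.trans (S.sym (+-homo _ _)) (S.trans (cong (R.-‿inverseˡ x)) 0-homo))
    where open GroupProperties S.+-group using (inverseˡ-unique)

-- Composed operators and iterated Leibniz rules.

binomialIf : ℕ → ℕ → ℕ → ℕ
binomialIf n i j = if does (i ℕ.+ j ℕ.≟ n) then (i ℕ.+ j) C i else 0

module Operators {c ℓ} (R : CommutativeRing c ℓ) where
  open CommutativeRing R hiding (zero)
  open RingOps R
  open FiniteSums R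
  open SetoidReasoning setoid
  open Mult semiring using (×-congʳ; ×-congˡ; ×-homo-1; ×-homo-+; ×-assocˡ; ×-assoc-*)

  Op : Set c
  Op = Carrier → Carrier

  -- Defined by recursion on m, so that inductions compute; `compose≡foldr` links it to the fold in
  -- `∂^`.
  compose : ∀ {m} → (Fin m → Op) → Op
  compose {zero}  E x = x
  compose {suc m} E x = E zero (compose (E ∘ suc) x)

  compose≡foldr : ∀ {m} (E : Fin m → Op) x → compose E x ≡ foldr E x (allFin m)
  compose≡foldr {zero}  E x = ≡.refl
  compose≡foldr {suc m} E x = ≡.trans (≡.cong (E zero) (compose≡foldr (E ∘ suc) x)) (≡.sym (foldr-allFin-suc E x))

  idAdditive : Additive R R id
  idAdditive = record { cong = id ; +-homo = λ _ _ → refl ; 0-homo = refl }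

  composeAdditive : ∀ {m} {E : Fin m → Op} → (∀ i → Additive R R (E i)) → Additive R R (compose E)
  composeAdditive {zero}  add = idAdditive
  composeAdditive {suc m} add = record
    { cong   = E₀.cong ∘ E₊.cong
    ; +-homo = λ x y → trans (E₀.cong (E₊.+-homo x y)) (E₀.+-homo _ _)
    ; 0-homo = trans (E₀.cong E₊.0-homo) E₀.0-homo
    }
    where
    module E₀ = Additive (add zero)
    module E₊ = Additive (composeAdditive (add ∘ suc))

  iterateAdditive : ∀ {D} → Additive R R D → ∀ n → Additive R R (λ x → iterate D x n)
  iterateAdditive         add zero    = idAdditive
  iterateAdditive {D = D} add (suc n) = record
    { cong   = Dⁿ.cong ∘ D.cong
    ; +-homo = λ x y → trans (Dⁿ.cong (D.+-homo x y)) (Dⁿ.+-homo _ _)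
    ; 0-homo = trans (Dⁿ.cong D.0-homo) Dⁿ.0-homo
    }
    where
    module D  = Additive add
    module Dⁿ = Additive (iterateAdditive add n)

  -- The pairs with i + j = k are selected by the weight w, which vanishes on all
  -- others; both sums can then run over the same list ↓ k.
  Leibniz : {K : Set} → (K → Op) → (K → List K) → (K → K → K → ℕ) → Set (c ⊔ ℓ)
  Leibniz E ↓ w = ∀ k x y → E k (x * y) ≈ ∑ (↓ k) λ i → ∑ (↓ k) λ j → w k i j · (E i x * E j y)

  ·-*ˡ : ∀ n x → n · x ≈ fromℕ n * x
  ·-*ˡ n x = trans (×-congʳ n (sym (*-identityˡ x))) (sym (×-assoc-* n 1# x))

  ·-∑ : ∀ {A : Set} n (xs : List A) {f : A → Carrier} → n · ∑ xs f ≈ ∑ xs (λ x → n · f x)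
  ·-∑ n xs = trans (·-*ˡ n _) (trans (∑-*ˡ _ xs) (∑-cong xs (λ x → sym (·-*ˡ n _))))

  -- Expand by the rules of the remaining operators, then by that of the first; the weights
  -- multiply. The index type `K i` may vary with i because the lemma is applied twice: to the
  -- coordinates of a block, where an index is a number, and to the blocks, where it is itself a
  -- function.
  compose-Leibniz : ∀ {m} {K : Fin m → Set} {E : ∀ i → K i → Op} {↓ : ∀ i → K i → List (K i)}
    {w : ∀ i → K i → K i → K i → ℕ} →
    (∀ i k → Additive R R (E i k)) → (∀ i → Leibniz (E i) (↓ i) (w i)) →
    Leibniz (λ k → compose λ i → E i (k i)) (λ k → functions λ i → ↓ i (k i))
            (λ k l l′ → prodFin λ i → w i (k i) (l i) (l′ i))
  compose-Leibniz {zero}  add leib k x y = begin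
    x * y                                ≈⟨ ×-homo-1 _ ⟨
    1 · (x * y)                          ≈⟨ +-identityʳ _ ⟨
    1 · (x * y) + 0#                     ≈⟨ +-identityʳ _ ⟨
    1 · (x * y) + 0# + 0#                ∎
  compose-Leibniz {suc m} {K} {E} {↓} {w} add leib k x y = begin
    E zero (k zero) (E₊ (k ∘ suc) (x * y))
      ≈⟨ E₀.cong (compose-Leibniz {↓ = λ a → ↓ (suc a)} {w = λ a → w (suc a)} (add ∘ suc) (leib ∘ suc) (k ∘ suc) x y) ⟩
    E zero (k zero) (∑ L₊ λ i → ∑ L₊ λ j → w₊ i j · (E₊ i x * E₊ j y))
      ≈⟨ trans (E₀.∑-homo L₊) (∑-cong L₊ λ i → trans (E₀.∑-homo L₊) (∑-cong L₊ λ j → E₀.·-homo (w₊ i j) _)) ⟩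
    ∑ L₊ (λ i → ∑ L₊ λ j → w₊ i j · E zero (k zero) (E₊ i x * E₊ j y))
      ≈⟨ ∑-cong L₊ (λ i → ∑-cong L₊ λ j → step i j) ⟩
    ∑ L₊ (λ i → ∑ L₊ λ j → ∑ L₀ λ i₀ → ∑ L₀ λ j₀ → T i₀ i j₀ j)
      -- `functions` enumerates the head outside the tail, so the order i, j, i₀, j₀ has to become
      -- i₀, i, j₀, j before each pair can be joined by `Fin.∀-cons`.
      ≈⟨ ∑-cong L₊ (λ i → ∑-swap L₊ L₀) ⟩
    ∑ L₊ (λ i → ∑ L₀ λ i₀ → ∑ L₊ λ j → ∑ L₀ λ j₀ → T i₀ i j₀ j)
      ≈⟨ ∑-swap L₊ L₀ ⟩
    ∑ L₀ (λ i₀ → ∑ L₊ λ i → ∑ L₊ λ j → ∑ L₀ λ j₀ → T i₀ i j₀ j)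
      ≈⟨ ∑-cong L₀ (λ i₀ → ∑-cong L₊ λ i → ∑-swap L₊ L₀) ⟩
    ∑ L₀ (λ i₀ → ∑ L₊ λ i → ∑ L₀ λ j₀ → ∑ L₊ λ j → T i₀ i j₀ j)
      ≈⟨ ∑-cong L₀ (λ i₀ → ∑-cong L₊ λ i → ∑-cong L₀ λ j₀ → ∑-cong L₊ λ j →
           ×-congˡ (≡.sym (prodFin-suc λ a → w a (k a) (Fin.∀-cons {P = K} i₀ i a) (Fin.∀-cons {P = K} j₀ j a)))) ⟩
    ∑ L₀ (λ i₀ → ∑ L₊ λ i → ∑ L₀ λ j₀ → ∑ L₊ λ j → U (Fin.∀-cons i₀ i) (Fin.∀-cons j₀ j))
      ≈⟨ ∑-cong L₀ (λ i₀ → ∑-cong L₊ λ i → sym (∑-functions-suc (λ a → ↓ a (k a)))) ⟩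
    ∑ L₀ (λ i₀ → ∑ L₊ λ i → ∑ L (λ j → U (Fin.∀-cons i₀ i) j))
      ≈⟨ sym (∑-functions-suc (λ a → ↓ a (k a))) ⟩
    ∑ L (λ i → ∑ L λ j → U i j) ∎
    where
    module E₀ = Additive (add zero (k zero))
    L  = functions λ a → ↓ a (k a)
    L₀ = ↓ zero (k zero)
    L₊ = functions λ a → ↓ (suc a) (k (suc a))
    E₊ : (∀ a → K (suc a)) → Op
    E₊ l = compose λ a → E (suc a) (l a)
    w₊ : (∀ a → K (suc a)) → (∀ a → K (suc a)) → ℕ
    w₊ i j = prodFin λ a → w (suc a) (k (suc a)) (i a) (j a)
    T : K zero → (∀ a → K (suc a)) → K zero → (∀ a → K (suc a)) → Carrier
    T i₀ i j₀ j = (w zero (k zero) i₀ j₀ ℕ.* w₊ i j) · (E zero i₀ (E₊ i x) * E zero j₀ (E₊ j y))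
    U : (∀ a → K a) → (∀ a → K a) → Carrier
    U i j = prodFin (λ a → w a (k a) (i a) (j a)) ·
              (compose (λ a → E a (i a)) x * compose (λ a → E a (j a)) y)
    step : ∀ i j → w₊ i j · E zero (k zero) (E₊ i x * E₊ j y) ≈ ∑ L₀ λ i₀ → ∑ L₀ λ j₀ → T i₀ i j₀ j
    step i j = begin
      w₊ i j · E zero (k zero) (E₊ i x * E₊ j y)
        ≈⟨ ×-congʳ (w₊ i j) (leib zero (k zero) (E₊ i x) (E₊ j y)) ⟩
      w₊ i j · ∑ L₀ (λ i₀ → ∑ L₀ λ j₀ → w zero (k zero) i₀ j₀ · (E zero i₀ (E₊ i x) * E zero j₀ (E₊ j y)))
        ≈⟨ trans (·-∑ (w₊ i j) L₀) (∑-cong L₀ λ i₀ → ·-∑ (w₊ i j) L₀) ⟩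
      ∑ L₀ (λ i₀ → ∑ L₀ λ j₀ → w₊ i j · (w zero (k zero) i₀ j₀ · (E zero i₀ (E₊ i x) * E zero j₀ (E₊ j y))))
        ≈⟨ ∑-cong L₀ (λ i₀ → ∑-cong L₀ λ j₀ → trans (×-assocˡ _ (w₊ i j) (w zero (k zero) i₀ j₀)) (×-congˡ (ℕ.*-comm (w₊ i j) (w zero (k zero) i₀ j₀)))) ⟩
      ∑ L₀ (λ i₀ → ∑ L₀ λ j₀ → T i₀ i j₀ j) ∎

  compose-*ˡ : ∀ {m} {E : Fin m → Op} → (∀ i → Additive R R (E i)) → ∀ {p} →
    (∀ i x → E i (p * x) ≈ p * E i x) → ∀ x → compose E (p * x) ≈ p * compose E x
  compose-*ˡ {zero}  add const x = refl
  compose-*ˡ {suc m} add const x =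
    trans (Additive.cong (add zero) (compose-*ˡ (add ∘ suc) (const ∘ suc) x)) (const zero _)

  pull-∏ : ∀ {A : Set} {E : Op} → Additive R R E → (ys : List A) {f : A → Carrier} →
    (∀ y x → E (x * f y) ≈ E x * f y) → ∀ x → E (x * ∏ ys f) ≈ E x * ∏ ys f
  pull-∏ add []               const x = trans (Additive.cong add (*-identityʳ x)) (sym (*-identityʳ _))
  pull-∏ {E = E} add (y ∷ ys) {f} const x = begin
    E (x * (f y * ∏ ys f))    ≈⟨ Additive.cong add (*-assoc _ _ _) ⟨
    E (x * f y * ∏ ys f)      ≈⟨ pull-∏ add ys const (x * f y) ⟩
    E (x * f y) * ∏ ys f      ≈⟨ *-congʳ (const y x) ⟩
    E x * f y * ∏ ys f        ≈⟨ *-assoc _ _ _ ⟩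
    E x * (f y * ∏ ys f)      ∎

  -- Each operator sees the other factors as constants. Two forms of this are required, since
  -- `E zero` acts last, on a product whose other factors have already been transformed by their own
  -- operators.
  compose-∏ : ∀ {m} {E : Fin m → Op} → (∀ i → Additive R R (E i)) → (f : Fin m → Carrier) →
    (∀ i j → i ≢ j → ∀ x → E i (f j * x) ≈ f j * E i x) →
    (∀ i j → i ≢ j → ∀ x → E i (x * E j (f j)) ≈ E i x * E j (f j)) →
    compose E (∏ (allFin m) f) ≈ ∏ (allFin m) λ i → E i (f i)
  compose-∏ {zero}          add f const const′ = refl
  compose-∏ {suc m} {E = E} add f const const′ = begin
    E zero (compose (E ∘ suc) (∏ (allFin (suc m)) f))
      ≈⟨ E₀.cong (Additive.cong (composeAdditive (add ∘ suc)) (∏-allFin-suc f)) ⟩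
    E zero (compose (E ∘ suc) (f zero * ∏ (allFin m) (f ∘ suc)))
      ≈⟨ E₀.cong (compose-*ˡ (add ∘ suc) (λ i → const (suc i) zero λ ()) _) ⟩
    E zero (f zero * compose (E ∘ suc) (∏ (allFin m) (f ∘ suc)))
      ≈⟨ E₀.cong (*-congˡ (compose-∏ (add ∘ suc) (f ∘ suc)
           (λ i j i≢j → const (suc i) (suc j) (i≢j ∘ Fin.suc-injective))
           (λ i j i≢j → const′ (suc i) (suc j) (i≢j ∘ Fin.suc-injective)))) ⟩
    E zero (f zero * ∏ (allFin m) λ i → E (suc i) (f (suc i)))
      ≈⟨ pull-∏ (add zero) (allFin m) (λ j → const′ zero (suc j) λ ()) (f zero) ⟩
    E zero (f zero) * ∏ (allFin m) (λ i → E (suc i) (f (suc i)))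
      ≈⟨ ∏-allFin-suc (λ i → E i (f i)) ⟨
    ∏ (allFin (suc m)) (λ i → E i (f i)) ∎
    where module E₀ = Additive (add zero)

  -- The Pascal step of `iterate-*`, freed from operators: `a i j` stands for the i-th derivative of
  -- one factor times the j-th derivative of the other.
  binomial-sum-suc : ∀ n (a : ℕ → ℕ → Carrier) →
    ∑ (upTo (suc n)) (λ i → (n C i) · a (suc i) (n ∸ i)) + ∑ (upTo (suc n)) (λ i → (n C i) · a i (suc n ∸ i))
      ≈ ∑ (upTo (2 ℕ.+ n)) λ i → (suc n C i) · a i (suc n ∸ i)
  binomial-sum-suc n a = begin
    ∑ (upTo (suc n)) (λ i → (n C i) · b (suc i)) + ∑ (upTo (suc n)) (λ i → (n C i) · b i)
      -- The appended term i = n + 1 has coefficient 0. Once i = 0 is split off, both sums run over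
      -- the same `b (suc i)` and Pascal's rule applies termwise.
      ≈⟨ +-congˡ (trans (+-congˡ (×-congˡ (k>n⇒nCk≡0 (ℕ.n<1+n n)))) (+-identityʳ _)) ⟨
    ∑ (upTo (suc n)) (λ i → (n C i) · b (suc i)) + (∑ (upTo (suc n)) (λ i → (n C i) · b i) + (n C suc n) · b (suc n))
      ≈⟨ +-congˡ (trans (sym (∑-upTo-last (suc n) _)) (∑-upTo-suc (suc n) _)) ⟩
    ∑ (upTo (suc n)) (λ i → (n C i) · b (suc i)) + ((n C 0) · b 0 + ∑ (upTo (suc n)) (λ i → (n C suc i) · b (suc i)))
      ≈⟨ trans (sym (+-assoc _ _ _)) (trans (+-congʳ (+-comm _ _)) (+-assoc _ _ _)) ⟩
    (n C 0) · b 0 + (∑ (upTo (suc n)) (λ i → (n C i) · b (suc i)) + ∑ (upTo (suc n)) (λ i → (n C suc i) · b (suc i)))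
      ≈⟨ +-cong refl (trans (sym (∑-+ (upTo (suc n))))
           (∑-cong (upTo (suc n)) λ i → trans (sym (×-homo-+ _ (n C i) (n C suc i))) (×-congˡ (nCk+nC[k+1]≡[n+1]C[k+1] n i)))) ⟩
    (suc n C 0) · b 0 + ∑ (upTo (suc n)) (λ i → (suc n C suc i) · b (suc i))
      ≈⟨ ∑-upTo-suc (suc n) (λ i → (suc n C i) · b i) ⟨
    ∑ (upTo (2 ℕ.+ n)) (λ i → (suc n C i) · b i) ∎
    where
    b : ℕ → Carrier
    b i = a i (suc n ∸ i)

  module _ {D : Op} (add : Additive R R D) (leibniz : ∀ x y → D (x * y) ≈ D x * y + x * D y) where
    iterate-* : ∀ n x y → iterate D (x * y) n ≈
      ∑ (upTo (suc n)) λ i → (n C i) · (iterate D x i * iterate D y (n ∸ i))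
    iterate-* zero    x y = sym (trans (+-identityʳ _) (×-homo-1 _))
    iterate-* (suc n) x y = begin
      iterate D (D (x * y)) n
        ≈⟨ Dⁿ.cong (leibniz x y) ⟩
      iterate D (D x * y + x * D y) n
        ≈⟨ Dⁿ.+-homo _ _ ⟩
      iterate D (D x * y) n + iterate D (x * D y) n
        ≈⟨ +-cong (iterate-* n (D x) y) (iterate-* n x (D y)) ⟩
      ∑ (upTo (suc n)) (λ i → (n C i) · a (suc i) (n ∸ i)) +
      ∑ (upTo (suc n)) (λ i → (n C i) · a i (suc (n ∸ i)))
        -- With truncated subtraction, `suc (n ∸ i)` equals `suc n ∸ i` only for i ≤ n, hence the
        -- congruence that knows the range.
        ≈⟨ +-congˡ (∑-upTo-cong (suc n) λ i i≤n →
             ×-congʳ (n C i) (reflexive (≡.cong (a i) (≡.sym (ℕ.+-∸-assoc 1 (ℕ.s≤s⁻¹ i≤n)))))) ⟩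
      ∑ (upTo (suc n)) (λ i → (n C i) · a (suc i) (n ∸ i)) +
      ∑ (upTo (suc n)) (λ i → (n C i) · a i (suc n ∸ i))
        ≈⟨ binomial-sum-suc n a ⟩
      ∑ (upTo (2 ℕ.+ n)) (λ i → (suc n C i) · a i (suc n ∸ i)) ∎
      where
      module Dⁿ = Additive (iterateAdditive add n)
      a : ℕ → ℕ → Carrier
      a i j = iterate D x i * iterate D y j

    -- For given i ≤ n the weight leaves a single j, namely `n ∸ i`, which does occur in the list
    -- because it is at most n.
    iterate-Leibniz : Leibniz (λ n x → iterate D x n) (upTo ∘ suc) binomialIf
    iterate-Leibniz n x y = trans (iterate-* n x y) (∑-upTo-cong (suc n) λ i i≤n → sym (begin
      ∑ (upTo (suc n)) (λ j → binomialIf n i j · a i j)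
        ≈⟨ ∑-cong (upTo (suc n)) (λ j → select i j (ℕ.s≤s⁻¹ i≤n)) ⟩
      ∑ (upTo (suc n)) (λ j → δ (n ∸ i ℕ.≟ j) * ((n C i) · a i (n ∸ i)))
        ≈⟨ ∑-*ʳ (upTo (suc n)) _ ⟨
      ∑ (upTo (suc n)) (λ j → δ (n ∸ i ℕ.≟ j)) * ((n C i) · a i (n ∸ i))
        ≈⟨ *-congʳ (trans (∑-upTo-δ (suc n) (n ∸ i)) (δ-yes (n ∸ i ℕ.<? suc n) (ℕ.s≤s (ℕ.m∸n≤m n i)))) ⟩
      1# * ((n C i) · a i (n ∸ i))
        ≈⟨ *-identityˡ _ ⟩
      (n C i) · a i (n ∸ i) ∎))
      where
      a : ℕ → ℕ → Carrier
      a i j = iterate D x i * iterate D y j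
      select : ∀ i j → i ℕ.≤ n → binomialIf n i j · a i j ≈ δ (n ∸ i ℕ.≟ j) * ((n C i) · a i (n ∸ i))
      select i j i≤n with i ℕ.+ j ℕ.≟ n
      ... | yes ≡.refl = begin
        binomialIf n i j · a i j                  ≈⟨ ×-congˡ (≡.cong (if_then (i ℕ.+ j) C i else 0) (dec-true (i ℕ.+ j ℕ.≟ n) ≡.refl)) ⟩
        (n C i) · a i j                           ≡⟨ ≡.cong (λ l → (n C i) · a i l) (ℕ.m+n∸m≡n i j) ⟨
        (n C i) · a i (n ∸ i)                     ≈⟨ *-identityˡ _ ⟨
        1# * ((n C i) · a i (n ∸ i))              ≈⟨ *-congʳ (δ-yes (n ∸ i ℕ.≟ j) (ℕ.m+n∸m≡n i j)) ⟨
        δ (n ∸ i ℕ.≟ j) * ((n C i) · a i (n ∸ i)) ∎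
      ... | no i+j≢n = begin
        binomialIf n i j · a i j                  ≈⟨ ×-congˡ (≡.cong (if_then (i ℕ.+ j) C i else 0) (dec-false (i ℕ.+ j ℕ.≟ n) i+j≢n)) ⟩
        0#                                        ≈⟨ zeroˡ _ ⟨
        0# * ((n C i) · a i (n ∸ i))              ≈⟨ *-congʳ (δ-no (n ∸ i ℕ.≟ j) λ e → i+j≢n (≡.trans (≡.cong (i ℕ.+_) (≡.sym e)) (ℕ.m+[n∸m]≡n i≤n))) ⟨
        δ (n ∸ i ℕ.≟ j) * ((n C i) · a i (n ∸ i)) ∎

-- Partial derivatives of polynomials.

module Derivatives {c ℓ} (R : CommutativeRing c ℓ) {V : Set} (_≟_ : DecidableEquality V) where
  open Polynomial R hiding (refl; sym; trans)
  open CommutativeRing (polyRing V) hiding (zero)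
  private module R = CommutativeRing R
  open RingOps (polyRing V)
  open FiniteSums (polyRing V)
  open Operators (polyRing V)
  open SetoidReasoning setoid
  open CommutativeSemigroupProperties +-commutativeSemigroup using (interchange; x∙yz≈y∙xz)

  ∂ᵥ : V → Op
  ∂ᵥ = ∂ _≟_

  ∂-additive : ∀ v → Additive (polyRing V) (polyRing V) (∂ᵥ v)
  ∂-additive v = record { cong = ∂-cong _≟_ v ; +-homo = λ _ _ → refl ; 0-homo = refl }

  ∂ⁿ-additive : ∀ v n → Additive (polyRing V) (polyRing V) (λ P → iterate (∂ᵥ v) P n)
  ∂ⁿ-additive v = iterateAdditive (∂-additive v)

  D : ∀ {m} → (Fin m → V) → (Fin m → ℕ) → Op
  D v k = compose λ i P → iterate (∂ᵥ (v i)) P (k i)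

  D-additive : ∀ {m} (v : Fin m → V) k → Additive (polyRing V) (polyRing V) (D v k)
  D-additive v k = composeAdditive λ i → ∂ⁿ-additive (v i) (k i)

  D-Leibniz : ∀ {m} (v : Fin m → V) →
    Leibniz (D v) (λ k → functions λ i → upTo (suc (k i))) (λ k i j → prodFin λ b → binomialIf (k b) (i b) (j b))
  D-Leibniz v = compose-Leibniz {E = λ i n P → iterate (∂ᵥ (v i)) P n} {↓ = λ _ n → upTo (suc n)} {w = λ _ → binomialIf}
    (λ i → ∂ⁿ-additive (v i)) (λ i → iterate-Leibniz (∂-additive (v i)) (λ _ _ → refl))

  ⟦⟧-additive : ∀ ρ → Additive (polyRing V) R (λ P → ⟦ P ⟧ ρ)
  ⟦⟧-additive ρ = record { cong = λ P≈Q → ⟦⟧-cong P≈Q ρ ; +-homo = λ _ _ → R.refl ; 0-homo = R.refl }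

  ∂-var-≡ : ∀ v → ∂ᵥ v (var v) ≈ 1#
  ∂-var-≡ v = reflexive (≡.cong (if_then con R.1# else con R.0#) (dec-true (v ≟ v) ≡.refl))

  ∂-var-≢ : ∀ {v u} → v ≢ u → ∂ᵥ v (var u) ≈ 0#
  ∂-var-≢ {v} {u} v≢u = reflexive (≡.cong (if_then con R.1# else con R.0#) (dec-false (v ≟ u) v≢u))

  -- In the product case only the two mixed terms change places. The lemma serves to show that being
  -- constant in u survives differentiation in other variables.
  ∂-comm : ∀ u v P → ∂ᵥ u (∂ᵥ v P) ≈ ∂ᵥ v (∂ᵥ u P)
  ∂-comm u v (con x) = refl
  ∂-comm u v (var w) with does (u ≟ w) | does (v ≟ w)
  ... | true  | true  = refl
  ... | true  | false = refl
  ... | false | true  = refl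
  ... | false | false = refl
  ∂-comm u v (P ⊕ Q) = +-cong (∂-comm u v P) (∂-comm u v Q)
  ∂-comm u v (P ⊗ Q) = trans (interchange _ _ _ _)
    (+-cong (+-congʳ (*-congʳ (∂-comm u v P))) (+-congˡ (*-congˡ (∂-comm u v Q))))
  ∂-comm u v (⊖ P)   = -‿cong (∂-comm u v P)

  ∂-∏-const : ∀ u {A : Set} (xs : List A) {f : A → Poly V} → (∀ x → ∂ᵥ u (f x) ≈ 0#) → ∂ᵥ u (∏ xs f) ≈ 0#
  ∂-∏-const u []       const = refl
  ∂-∏-const u (x ∷ xs) const =
    trans (+-cong (trans (*-congʳ (const x)) (zeroˡ _)) (trans (*-congˡ (∂-∏-const u xs const)) (zeroʳ _))) (+-identityˡ _)

  ∂ⁿ-const : ∀ {u} v n {P} → ∂ᵥ u P ≈ 0# → ∂ᵥ u (iterate (∂ᵥ v) P n) ≈ 0#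
  ∂ⁿ-const v zero    const = const
  ∂ⁿ-const {u} v (suc n) {P} const =
    ∂ⁿ-const v n (trans (∂-comm u v P) (∂-cong _≟_ v const))

  D-const : ∀ {u m} (v : Fin m → V) k {P} → ∂ᵥ u P ≈ 0# → ∂ᵥ u (D v k P) ≈ 0#
  D-const {m = zero}  v k const = const
  D-const {m = suc m} v k const = ∂ⁿ-const (v zero) (k zero) (D-const (v ∘ suc) (k ∘ suc) const)

  -- Constancy in v is expressed by a vanishing derivative. In positive characteristic this is
  -- weaker than absence of the variable, but it is exactly what the product rule uses.
  ∂ⁿ-*ˡ : ∀ v n {P} → ∂ᵥ v P ≈ 0# → ∀ Q → iterate (∂ᵥ v) (P * Q) n ≈ P * iterate (∂ᵥ v) Q n
  ∂ⁿ-*ˡ v zero    const Q = refl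
  ∂ⁿ-*ˡ v (suc n) const Q =
    trans (Additive.cong (∂ⁿ-additive v n) (trans (+-congʳ (trans (*-congʳ const) (zeroˡ Q))) (+-identityˡ _)))
      (∂ⁿ-*ˡ v n const (∂ᵥ v Q))

  D-*ˡ : ∀ {m} (v : Fin m → V) k {P} → (∀ i → ∂ᵥ (v i) P ≈ 0#) → ∀ Q → D v k (P * Q) ≈ P * D v k Q
  D-*ˡ v k const = compose-*ˡ (λ i → ∂ⁿ-additive (v i) (k i)) (λ i → ∂ⁿ-*ˡ (v i) (k i) (const i))

  D-*ʳ : ∀ {m} (v : Fin m → V) k {P} → (∀ i → ∂ᵥ (v i) P ≈ 0#) → ∀ Q → D v k (Q * P) ≈ D v k Q * P
  D-*ʳ v k const Q = trans (Additive.cong (D-additive v k) (*-comm _ _)) (trans (D-*ˡ v k const Q) (*-comm _ _))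

  -- The Leibniz sum stops after two terms because the derivative of the variable is 1. The value of
  -- `pred` at 0 is harmless, as its term then has coefficient 0.
  ∂ⁿ-var-* : ∀ v n P → iterate (∂ᵥ v) (var v * P) n ≈ var v * iterate (∂ᵥ v) P n + n · iterate (∂ᵥ v) P (pred n)
  ∂ⁿ-var-* v zero    P = sym (+-identityʳ _)
  ∂ⁿ-var-* v (suc n) P = begin
    iterate (∂ᵥ v) (∂ᵥ v (var v) * P + var v * ∂ᵥ v P) n
      ≈⟨ Dⁿ.cong (+-congʳ (trans (*-congʳ (∂-var-≡ v)) (*-identityˡ P))) ⟩
    iterate (∂ᵥ v) (P + var v * ∂ᵥ v P) n
      ≈⟨ Dⁿ.+-homo _ _ ⟩
    iterate (∂ᵥ v) P n + iterate (∂ᵥ v) (var v * ∂ᵥ v P) n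
      ≈⟨ +-congˡ (trans (∂ⁿ-var-* v n (∂ᵥ v P)) (+-congˡ (shift n))) ⟩
    iterate (∂ᵥ v) P n + (var v * iterate (∂ᵥ v) P (suc n) + n · iterate (∂ᵥ v) P n)
      ≈⟨ x∙yz≈y∙xz _ _ _ ⟩
    var v * iterate (∂ᵥ v) P (suc n) + suc n · iterate (∂ᵥ v) P n ∎
    where
    module Dⁿ = Additive (∂ⁿ-additive v n)
    shift : ∀ n → n · iterate (∂ᵥ v) (∂ᵥ v P) (pred n) ≈ n · iterate (∂ᵥ v) P n
    shift zero    = refl
    shift (suc n) = refl

  -- By injectivity of `v`, the factor `var (v b)` is a constant for all coordinates except b, so
  -- only the derivatives in that coordinate produce the second term.
  D-var-* : ∀ {m} (v : Fin m → V) → Injective _≡_ _≡_ v → ∀ k b P →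
    D v k (var (v b) * P) ≈ var (v b) * D v k P + k b · D v (updateAt k b pred) P
  D-var-* v inj k zero P =
    trans (Additive.cong (∂ⁿ-additive (v zero) (k zero))
            (D-*ˡ (v ∘ suc) (k ∘ suc) (λ i → ∂-var-≢ λ e → Fin.0≢1+n (≡.sym (inj e))) P))
      (∂ⁿ-var-* (v zero) (k zero) _)
  D-var-* v inj k (suc b) P = begin
    iterate (∂ᵥ (v zero)) (D (v ∘ suc) (k ∘ suc) (var (v (suc b)) * P)) (k zero)
      ≈⟨ Dⁿ.cong (D-var-* (v ∘ suc) (Fin.suc-injective ∘ inj) (k ∘ suc) b P) ⟩
    iterate (∂ᵥ (v zero)) (var (v (suc b)) * D (v ∘ suc) (k ∘ suc) P + k (suc b) · D (v ∘ suc) (updateAt (k ∘ suc) b pred) P) (k zero)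
      ≈⟨ Dⁿ.+-homo _ _ ⟩
    iterate (∂ᵥ (v zero)) (var (v (suc b)) * D (v ∘ suc) (k ∘ suc) P) (k zero) +
    iterate (∂ᵥ (v zero)) (k (suc b) · D (v ∘ suc) (updateAt (k ∘ suc) b pred) P) (k zero)
      ≈⟨ +-cong (∂ⁿ-*ˡ (v zero) (k zero) (∂-var-≢ λ e → Fin.0≢1+n (inj e)) _) (Dⁿ.·-homo (k (suc b)) _) ⟩
    var (v (suc b)) * D v k P + k (suc b) · D v (updateAt k (suc b) pred) P ∎
    where module Dⁿ = Additive (∂ⁿ-additive (v zero) (k zero))

-- Falling factorials, and sums and products over coordinates in ℕ.

P′-vanishes : ∀ {n k} → n ℕ.< k → n P′ k ≡ 0
P′-vanishes {n} {suc k} n<1+k with ℕ.m<1+n⇒m<n∨m≡n n<1+k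
... | inj₁ n<k    = ≡.trans (≡.cong ((n ∸ k) ℕ.*_) (P′-vanishes n<k)) (ℕ.*-zeroʳ (n ∸ k))
... | inj₂ ≡.refl = ≡.cong (ℕ._* (n P′ n)) (ℕ.n∸n≡0 n)

-- The defining recursion of `_P′_` splits off the smallest factor `n ∸ k`; here the largest one, n,
-- is split off.
P′-suc : ∀ n k → n P′ suc k ≡ n ℕ.* (pred n P′ k)
P′-suc zero    k = ≡.cong (ℕ._* (0 P′ k)) (ℕ.0∸n≡0 k)
P′-suc (suc n) k = nP′k≡n[n∸1P′k∸1] (suc n) (suc k)

-- The finite-difference rule for falling factorials, the discrete form of differentiating a power.
-- For j ≤ m it is m + 1 = (m - j) + (j + 1); for j > m all terms vanish.
P′-pascal : ∀ m j → suc m P′ suc j ≡ m P′ suc j ℕ.+ suc j ℕ.* (m P′ j)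
P′-pascal m j with j ℕ.≤? m
... | yes j≤m = begin
  suc m P′ suc j                                   ≡⟨ P′-suc (suc m) j ⟩
  suc m ℕ.* (m P′ j)                               ≡⟨ ≡.cong (λ l → suc l ℕ.* (m P′ j)) (ℕ.m∸n+n≡m j≤m) ⟨
  suc (m ∸ j ℕ.+ j) ℕ.* (m P′ j)                   ≡⟨ ≡.cong (ℕ._* (m P′ j)) (ℕ.+-suc (m ∸ j) j) ⟨
  (m ∸ j ℕ.+ suc j) ℕ.* (m P′ j)                   ≡⟨ ℕ.*-distribʳ-+ (m P′ j) (m ∸ j) (suc j) ⟩
  (m ∸ j) ℕ.* (m P′ j) ℕ.+ suc j ℕ.* (m P′ j)      ∎
  where open ≡-Reasoning
... | no j≰m = begin
  suc m P′ suc j                                   ≡⟨ P′-vanishes (ℕ.s<s (ℕ.≰⇒> j≰m)) ⟩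
  0                                                ≡⟨ ℕ.*-zeroʳ (m ∸ j ℕ.+ suc j) ⟨
  (m ∸ j ℕ.+ suc j) ℕ.* 0                          ≡⟨ ≡.cong ((m ∸ j ℕ.+ suc j) ℕ.*_) (P′-vanishes (ℕ.≰⇒> j≰m)) ⟨
  (m ∸ j ℕ.+ suc j) ℕ.* (m P′ j)                   ≡⟨ ℕ.*-distribʳ-+ (m P′ j) (m ∸ j) (suc j) ⟩
  (m ∸ j) ℕ.* (m P′ j) ℕ.+ suc j ℕ.* (m P′ j)      ∎
  where open ≡-Reasoning

sumFin-cong : ∀ {m} {u v : Fin m → ℕ} → u ≗ v → sumFin u ≡ sumFin v
sumFin-cong {m} u≗v = ≡.cong (foldr ℕ._+_ 0) (List.map-cong u≗v (allFin m))

prodFin-cong : ∀ {m} {u v : Fin m → ℕ} → u ≗ v → prodFin u ≡ prodFin v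
prodFin-cong {m} u≗v = ≡.cong (foldr ℕ._*_ 1) (List.map-cong u≗v (allFin m))

sumFin-mono : ∀ {m} {u v : Fin m → ℕ} → (∀ b → u b ℕ.≤ v b) → sumFin u ℕ.≤ sumFin v
sumFin-mono {zero}          u≤v = ℕ.z≤n
sumFin-mono {suc m} {u} {v} u≤v = ≡.subst₂ ℕ._≤_ (≡.sym (sumFin-suc u)) (≡.sym (sumFin-suc v))
  (ℕ.+-mono-≤ (u≤v zero) (sumFin-mono (u≤v ∘ suc)))

sumFin-0 : ∀ {m} → sumFin {m} (λ _ → 0) ≡ 0
sumFin-0 {zero}  = ≡.refl
sumFin-0 {suc m} = ≡.trans (sumFin-suc {m} (λ _ → 0)) (sumFin-0 {m})

-- Truncated subtraction respects sums only under coordinatewise domination; adding `sumFin v` back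
-- makes every difference exact.
sumFin-∸ : ∀ {m} {u v : Fin m → ℕ} → (∀ b → v b ℕ.≤ u b) → sumFin (λ b → u b ∸ v b) ≡ sumFin u ∸ sumFin v
sumFin-∸ {u = u} {v} v≤u = ≡.trans (≡.sym (ℕ.m+n∸n≡m _ (sumFin v))) (≡.cong (_∸ sumFin v) (go v≤u))
  where
  open ≡-Reasoning
  go : ∀ {m} {u v : Fin m → ℕ} → (∀ b → v b ℕ.≤ u b) → sumFin (λ b → u b ∸ v b) ℕ.+ sumFin v ≡ sumFin u
  go {zero}          v≤u = ≡.refl
  go {suc m} {u} {v} v≤u = begin
    sumFin (λ b → u b ∸ v b) ℕ.+ sumFin v
      ≡⟨ ≡.cong₂ ℕ._+_ (sumFin-suc (λ b → u b ∸ v b)) (sumFin-suc v) ⟩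
    (u zero ∸ v zero ℕ.+ sumFin (λ b → u (suc b) ∸ v (suc b))) ℕ.+ (v zero ℕ.+ sumFin (v ∘ suc))
      ≡⟨ interchange (u zero ∸ v zero) _ (v zero) _ ⟩
    (u zero ∸ v zero ℕ.+ v zero) ℕ.+ (sumFin (λ b → u (suc b) ∸ v (suc b)) ℕ.+ sumFin (v ∘ suc))
      ≡⟨ ≡.cong₂ ℕ._+_ (ℕ.m∸n+n≡m (v≤u zero)) (go (v≤u ∘ suc)) ⟩
    u zero ℕ.+ sumFin (u ∘ suc)
      ≡⟨ sumFin-suc u ⟨
    sumFin u ∎
    where open CommutativeSemigroupProperties ℕ.+-commutativeSemigroup using (interchange)

-- Phrased by behaviour at b and away from b, so that it covers both raising and lowering a
-- coordinate.
sumFin-bump : ∀ {m} (b : Fin m) {u v : Fin m → ℕ} → u b ≡ suc (v b) → (∀ i → i ≢ b → u i ≡ v i) →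
  sumFin u ≡ suc (sumFin v)
sumFin-bump zero {u} {v} at off = begin
  sumFin u                             ≡⟨ sumFin-suc u ⟩
  u zero ℕ.+ sumFin (u ∘ suc)          ≡⟨ ≡.cong₂ ℕ._+_ at (sumFin-cong λ i → off (suc i) λ ()) ⟩
  suc (v zero) ℕ.+ sumFin (v ∘ suc)    ≡⟨ ≡.cong suc (sumFin-suc v) ⟨
  suc (sumFin v)                       ∎
  where open ≡-Reasoning
sumFin-bump (suc b) {u} {v} at off = begin
  sumFin u                             ≡⟨ sumFin-suc u ⟩
  u zero ℕ.+ sumFin (u ∘ suc)          ≡⟨ ≡.cong₂ ℕ._+_ (off zero λ ()) (sumFin-bump b at λ i i≢b → off (suc i) (i≢b ∘ Fin.suc-injective)) ⟩
  v zero ℕ.+ suc (sumFin (v ∘ suc))    ≡⟨ ℕ.+-suc _ _ ⟩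
  suc (v zero ℕ.+ sumFin (v ∘ suc))    ≡⟨ ≡.cong suc (sumFin-suc v) ⟨
  suc (sumFin v)                       ∎
  where open ≡-Reasoning

prodFin-scale : ∀ {m} (b : Fin m) c {u v : Fin m → ℕ} → u b ≡ c ℕ.* v b → (∀ i → i ≢ b → u i ≡ v i) →
  prodFin u ≡ c ℕ.* prodFin v
prodFin-scale zero c {u} {v} at off = begin
  prodFin u                              ≡⟨ prodFin-suc u ⟩
  u zero ℕ.* prodFin (u ∘ suc)           ≡⟨ ≡.cong₂ ℕ._*_ at (prodFin-cong λ i → off (suc i) λ ()) ⟩
  c ℕ.* v zero ℕ.* prodFin (v ∘ suc)     ≡⟨ ℕ.*-assoc c _ _ ⟩
  c ℕ.* (v zero ℕ.* prodFin (v ∘ suc))   ≡⟨ ≡.cong (c ℕ.*_) (prodFin-suc v) ⟨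
  c ℕ.* prodFin v                        ∎
  where open ≡-Reasoning
prodFin-scale (suc b) c {u} {v} at off = begin
  prodFin u                              ≡⟨ prodFin-suc u ⟩
  u zero ℕ.* prodFin (u ∘ suc)           ≡⟨ ≡.cong₂ ℕ._*_ (off zero λ ()) (prodFin-scale b c at λ i i≢b → off (suc i) (i≢b ∘ Fin.suc-injective)) ⟩
  v zero ℕ.* (c ℕ.* prodFin (v ∘ suc))   ≡⟨ x∙yz≈y∙xz (v zero) c _ ⟩
  c ℕ.* (v zero ℕ.* prodFin (v ∘ suc))   ≡⟨ ≡.cong (c ℕ.*_) (prodFin-suc v) ⟨
  c ℕ.* prodFin v                        ∎
  where
  open ≡-Reasoning
  open CommutativeSemigroupProperties ℕ.*-commutativeSemigroup using (x∙yz≈y∙xz)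

-- The product of the k_b! / (k_b - s_b)! from `S`, written without division and therefore zero as
-- soon as some s_b exceeds k_b.
falling : ∀ {m} → (Fin m → ℕ) → (Fin m → ℕ) → ℕ
falling k s = prodFin λ b → k b P′ s b

sumFin-updateAt-suc : ∀ {m} (s : Fin m → ℕ) b → sumFin (updateAt s b suc) ≡ suc (sumFin s)
sumFin-updateAt-suc s b = sumFin-bump b (updateAt-updates b s) (λ i → updateAt-minimal i b s)

sumFin-updateAt-pred : ∀ {m} (k : Fin m → ℕ) b → k b ≢ 0 → sumFin k ≡ suc (sumFin (updateAt k b pred))
sumFin-updateAt-pred k b kb≢0 = sumFin-bump b
  (≡.sym (≡.trans (≡.cong suc (updateAt-updates b k)) (ℕ.suc-pred (k b) {{ℕ.≢-nonZero kb≢0}})))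
  (λ i i≢b → ≡.sym (updateAt-minimal i b k i≢b))

module _ {m} (k s : Fin m → ℕ) (b : Fin m) where

  -- The scaling lemma with factor 0, comparing the function with itself.
  falling-vanishes : k b ℕ.< s b → falling k s ≡ 0
  falling-vanishes kb<sb = prodFin-scale b 0 {v = λ b → k b P′ s b} (P′-vanishes kb<sb) (λ _ _ → ≡.refl)

  -- The additional factor is split off as the smallest one here and as the largest one in
  -- `falling-suc-pred`. The first form can be summed over b in `∑-Φ-suc`; the second lowers the
  -- order of derivation in `Φ-suc-var`.
  falling-suc-∸ : falling k (updateAt s b suc) ≡ (k b ∸ s b) ℕ.* falling k s
  falling-suc-∸ = prodFin-scale b (k b ∸ s b)
    (≡.cong (k b P′_) (updateAt-updates b s)) (λ i i≢b → ≡.cong (k i P′_) (updateAt-minimal i b s i≢b))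

  falling-suc-pred : falling k (updateAt s b suc) ≡ k b ℕ.* falling (updateAt k b pred) s
  falling-suc-pred = prodFin-scale b (k b)
    (≡.trans (≡.cong (k b P′_) (updateAt-updates b s))
      (≡.trans (P′-suc (k b) (s b)) (≡.cong (λ l → k b ℕ.* (l P′ s b)) (≡.sym (updateAt-updates b k)))))
    (λ i i≢b → ≡.cong₂ _P′_ (≡.sym (updateAt-minimal i b k i≢b)) (updateAt-minimal i b s i≢b))

-- Weights of syndromes in one block.

-- wt γ a unfolds to count (γ a).
count : ∀ {n p} → (Fin n → Fin (suc p)) → Fin p → ℕ
count {n} γ b = length (filter (λ c → γ c Fin.≟ suc b) (allFin n))

length-filter-tabulate : ∀ {A B : Set} {P : B → Set} (P? : ∀ x → Dec (P x)) (h : A → B) {m} (u : Fin m → A) →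
  length (filter P? (tabulate (h ∘ u))) ≡ length (filter (P? ∘ h) (tabulate u))
length-filter-tabulate P? h {zero}  u = ≡.refl
length-filter-tabulate P? h {suc m} u with does (P? (h (u zero)))
... | true  = ≡.cong suc (length-filter-tabulate P? h (u ∘ suc))
... | false = length-filter-tabulate P? h (u ∘ suc)

count-≡ : ∀ {n p} (γ : Fin (suc n) → Fin (suc p)) b → γ zero ≡ suc b → count γ b ≡ suc (count (γ ∘ suc) b)
count-≡ γ b e = ≡.trans (≡.cong length (List.filter-accept (λ c → γ c Fin.≟ suc b) e))
  (≡.cong suc (length-filter-tabulate (λ c → γ c Fin.≟ suc b) suc id))

count-≢ : ∀ {n p} (γ : Fin (suc n) → Fin (suc p)) b → γ zero ≢ suc b → count γ b ≡ count (γ ∘ suc) b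
count-≢ γ b e = ≡.trans (≡.cong length (List.filter-reject (λ c → γ c Fin.≟ suc b) e))
  (length-filter-tabulate (λ c → γ c Fin.≟ suc b) suc id)

count-zero : ∀ {n p} (γ : Fin (suc n) → Fin (suc p)) → γ zero ≡ zero → count γ ≗ count (γ ∘ suc)
count-zero γ e b = count-≢ γ b λ e′ → Fin.0≢1+n (≡.trans (≡.sym e) e′)

count-suc : ∀ {n p} (γ : Fin (suc n) → Fin (suc p)) {b} → γ zero ≡ suc b → count γ ≗ updateAt (count (γ ∘ suc)) b suc
count-suc γ {b} e i with i Fin.≟ b
... | yes ≡.refl = ≡.trans (count-≡ γ i e) (≡.sym (updateAt-updates b (count (γ ∘ suc))))
... | no  i≢b    = ≡.trans (count-≢ γ i λ e′ → i≢b (Fin.suc-injective (≡.trans (≡.sym e′) e)))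
  (≡.sym (updateAt-minimal i b (count (γ ∘ suc)) i≢b))

sum-count-suc : ∀ {n p} (γ : Fin (suc n) → Fin (suc p)) {b} → γ zero ≡ suc b →
  sumFin (count γ) ≡ suc (sumFin (count (γ ∘ suc)))
sum-count-suc γ {b} e = ≡.trans (sumFin-cong (count-suc γ e)) (sumFin-updateAt-suc (count (γ ∘ suc)) b)

-- Makes `n ∸ sumFin (count γ)`, the number of positions where γ is zero, an honest difference.
sum-count≤ : ∀ {n p} (γ : Fin n → Fin (suc p)) → sumFin (count γ) ℕ.≤ n
sum-count≤ {zero}  {p} γ = ℕ.≤-reflexive (sumFin-0 {p})
sum-count≤ {suc n} γ = go (γ zero) ≡.refl
  where
  go : ∀ v → γ zero ≡ v → sumFin (count γ) ℕ.≤ suc n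
  go zero    e = ℕ.m≤n⇒m≤1+n (≡.subst (ℕ._≤ n) (≡.sym (sumFin-cong (count-zero γ e))) (sum-count≤ (γ ∘ suc)))
  go (suc b) e = ≡.subst (ℕ._≤ suc n) (≡.sym (sum-count-suc γ e)) (ℕ.s≤s (sum-count≤ (γ ∘ suc)))

count≡0⇒zero : ∀ {n p} (γ : Fin n → Fin (suc p)) → (∀ b → count γ b ≡ 0) → ∀ c → γ c ≡ zero
count≡0⇒zero {suc n} γ count≡0 = go (γ zero) ≡.refl
  where
  go : ∀ v → γ zero ≡ v → ∀ c → γ c ≡ zero
  go (suc b) e _       = contradiction (≡.trans (≡.sym (count-≡ γ b e)) (count≡0 b)) (λ ())
  go zero    e zero    = e
  go zero    e (suc c) = count≡0⇒zero (γ ∘ suc) (λ b → ≡.trans (≡.sym (count-zero γ e b)) (count≡0 b)) c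

-- The closed form for one block.

module BlockWeights {c ℓ} (R : CommutativeRing c ℓ) where
  open CommutativeRing R hiding (zero)
  open RingOps R
  open FiniteSums R
  open SetoidReasoning setoid
  open RingProperties ring using (-1*x≈-x; -0#≈0#)
  open SemiringSolver commutativeSemiring using (solve; _:*_; _:+_; _:=_)

  -- The derivative ∂ᵏ at w = 0 of (1 − ∑ w_b)ᵐ ∏ w_b ^ s_b.
  Φ : ∀ {p} → (Fin p → ℕ) → ℕ → (Fin p → ℕ) → Carrier
  Φ k m s = (- 1#) ^ (sumFin k ∸ sumFin s) * fromℕ (m P′ (sumFin k ∸ sumFin s)) * fromℕ (falling k s)

  Φ-cong : ∀ {p} (k : Fin p → ℕ) m {s s′} → s ≗ s′ → Φ k m s ≈ Φ k m s′
  Φ-cong k m {s} {s′} s≗s′ = reflexive (≡.cong₂ (λ t u → (- 1#) ^ (sumFin k ∸ t) * fromℕ (m P′ (sumFin k ∸ t)) * fromℕ u)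
    (sumFin-cong s≗s′) (prodFin-cong λ b → ≡.cong (k b P′_) (s≗s′ b)))

  module _ {p} (k : Fin p → ℕ) (m : ℕ) (s : Fin p → ℕ) where

    Φ-vanishes : falling k s ≡ 0 → Φ k m s ≈ 0#
    Φ-vanishes e = trans (*-congˡ (reflexive (≡.cong fromℕ e))) (zeroʳ _)

    -- The recursion for multiplication by w_b. If k b > 0, raising s and lowering k change |k| -
    -- |s| in the same way, so the sign and the falling factorial of m agree; if k b = 0, both sides
    -- vanish.
    Φ-suc-var : ∀ b → Φ k m (updateAt s b suc) ≈ fromℕ (k b) * Φ (updateAt k b pred) m s
    Φ-suc-var b with k b ℕ.≟ 0
    ... | yes kb≡0 = trans
      (trans (*-congˡ (reflexive (≡.cong fromℕ (≡.trans (falling-suc-pred k s b) (≡.cong (ℕ._* falling (updateAt k b pred) s) kb≡0))))) (zeroʳ _))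
      (sym (trans (*-congʳ (reflexive (≡.cong fromℕ kb≡0))) (zeroˡ _)))
    ... | no kb≢0 = begin
      Φ k m (updateAt s b suc)
        ≡⟨ ≡.cong₂ (λ j u → (- 1#) ^ j * fromℕ (m P′ j) * fromℕ u)
             (≡.cong₂ _∸_ (sumFin-updateAt-pred k b kb≢0) (sumFin-updateAt-suc s b)) (falling-suc-pred k s b) ⟩
      σ * α * fromℕ (k b ℕ.* falling (updateAt k b pred) s)
        ≈⟨ *-congˡ (fromℕ-* (k b) _) ⟩
      σ * α * (fromℕ (k b) * fromℕ (falling (updateAt k b pred) s))
        ≈⟨ solve 3 (λ x y z → x :* (y :* z) := y :* (x :* z)) refl (σ * α) (fromℕ (k b)) _ ⟩
      fromℕ (k b) * Φ (updateAt k b pred) m s ∎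
      where
      σ = (- 1#) ^ (sumFin (updateAt k b pred) ∸ sumFin s)
      α = fromℕ (m P′ (sumFin (updateAt k b pred) ∸ sumFin s))

    -- All summands have the same order |k| - |s| - 1, so everything except the factor `k b ∸ s b`
    -- comes out. The sum of these truncated differences is evaluated later, once s ≤ k is known.
    ∑-Φ-suc : ∑ (allFin p) (λ b → Φ k m (updateAt s b suc)) ≈
      (- 1#) ^ pred (sumFin k ∸ sumFin s) * fromℕ (m P′ pred (sumFin k ∸ sumFin s)) *
        (fromℕ (sumFin λ b → k b ∸ s b) * fromℕ (falling k s))
    ∑-Φ-suc = begin
      ∑ (allFin p) (λ b → Φ k m (updateAt s b suc))
        ≈⟨ ∑-cong (allFin p) (λ b → trans (reflexive (≡.cong₂ (λ j u → (- 1#) ^ j * fromℕ (m P′ j) * fromℕ u)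
             (≡.trans (≡.cong (sumFin k ∸_) (sumFin-updateAt-suc s b)) (≡.sym (ℕ.pred[m∸n]≡m∸[1+n] (sumFin k) (sumFin s))))
             (falling-suc-∸ k s b))) (*-congˡ (fromℕ-* (k b ∸ s b) (falling k s)))) ⟩
      ∑ (allFin p) (λ b → X * (fromℕ (k b ∸ s b) * fromℕ (falling k s)))
        ≈⟨ ∑-*ˡ X (allFin p) ⟨
      X * ∑ (allFin p) (λ b → fromℕ (k b ∸ s b) * fromℕ (falling k s))
        ≈⟨ *-congˡ (trans (sym (∑-*ʳ (allFin p) _)) (*-congʳ (∑-fromℕ (λ b → k b ∸ s b)))) ⟩
      X * (fromℕ (sumFin λ b → k b ∸ s b) * fromℕ (falling k s)) ∎
      where X = (- 1#) ^ pred (sumFin k ∸ sumFin s) * fromℕ (m P′ pred (sumFin k ∸ sumFin s))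

    -- Mirrors the expansion of one factor of (1 - ∑ w_b)^(m+1). With j = |k| - |s|, dividing out
    -- the common factors leaves the rule `P′-pascal`, the sign of the difference being absorbed by
    -- the change from j to j - 1.
    Φ-suc-zero : Φ k (suc m) s ≈ Φ k m s + - ∑ (allFin p) (λ b → Φ k m (updateAt s b suc))
    Φ-suc-zero with Fin.all? (λ b → s b ℕ.≤? k b)
    ... | yes s≤k = trans (go (sumFin k ∸ sumFin s)) (+-congˡ (-‿cong (sym (trans ∑-Φ-suc
            (reflexive (≡.cong (λ j → (- 1#) ^ pred (sumFin k ∸ sumFin s) * fromℕ (m P′ pred (sumFin k ∸ sumFin s)) * (fromℕ j * B)) (sumFin-∸ s≤k)))))))
      where
      B = fromℕ (falling k s)
      go : ∀ j → (- 1#) ^ j * fromℕ (suc m P′ j) * B ≈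
        (- 1#) ^ j * fromℕ (m P′ j) * B + - ((- 1#) ^ pred j * fromℕ (m P′ pred j) * (fromℕ j * B))
      -- The value of `pred` at 0 does not matter, since its term carries the factor `fromℕ 0`.
      go zero    = sym (trans (+-congˡ (trans (-‿cong (trans (*-congˡ (zeroˡ B)) (zeroʳ _))) -0#≈0#)) (+-identityʳ _))
      go (suc j) = begin
        - 1# * σ * fromℕ (suc m P′ suc j) * B
          ≈⟨ *-congʳ (*-congˡ (trans (reflexive (≡.cong fromℕ (P′-pascal m j))) (trans (fromℕ-+ (m P′ suc j) _) (+-congˡ (fromℕ-* (suc j) (m P′ j)))))) ⟩
        - 1# * σ * (fromℕ (m P′ suc j) + fromℕ (suc j) * fromℕ (m P′ j)) * B
          ≈⟨ solve 6 (λ e σ x y z b → e :* σ :* (x :+ y :* z) :* b := e :* σ :* x :* b :+ e :* (σ :* z :* (y :* b))) refl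
               (- 1#) σ (fromℕ (m P′ suc j)) (fromℕ (suc j)) (fromℕ (m P′ j)) B ⟩
        - 1# * σ * fromℕ (m P′ suc j) * B + - 1# * (σ * fromℕ (m P′ j) * (fromℕ (suc j) * B))
          ≈⟨ +-congˡ (-1*x≈-x _) ⟩
        - 1# * σ * fromℕ (m P′ suc j) * B + - (σ * fromℕ (m P′ j) * (fromℕ (suc j) * B)) ∎
        where σ = (- 1#) ^ j
    -- Some s b exceeds k b, and the factor `falling k s`, present in all terms, is zero.
    ... | no s≰k = begin
      Φ k (suc m) s
        ≈⟨ trans (*-congˡ B≈0) (zeroʳ _) ⟩
      0#
        ≈⟨ trans (+-congˡ -0#≈0#) (+-identityʳ 0#) ⟨
      0# + - 0#
        ≈⟨ +-cong (trans (*-congˡ B≈0) (zeroʳ _)) (-‿cong (trans ∑-Φ-suc (trans (*-congˡ (trans (*-congˡ B≈0) (zeroʳ _))) (zeroʳ _)))) ⟨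
      Φ k m s + - ∑ (allFin p) (λ b → Φ k m (updateAt s b suc)) ∎
      where
      B≈0 : fromℕ (falling k s) ≈ 0#
      B≈0 with b , sb≰kb ← Fin.¬∀⟶∃¬ p _ (λ b → s b ℕ.≤? k b) s≰k =
        reflexive (≡.cong fromℕ (falling-vanishes k s b (ℕ.≰⇒> sb≰kb)))

  -- S k s unfolds to the product over a of Sᵃ (n a) (k a) (s a).
  Sᵃ : ∀ {p} → ℕ → (Fin p → ℕ) → (Fin p → ℕ) → Carrier
  Sᵃ {p} n k s =
    δ (sumFin k ℕ.≤? n)
    * (- 1#) ^ (sumFin k ∸ sumFin s)
    * fromℕ (((n ∸ sumFin s) ! / (n ∸ sumFin k) !) {{(n ∸ sumFin k) ℕ.!≢0}})
    * ∏ (allFin p) λ b → fromℕ ((k b ! / (k b ∸ s b) !) {{(k b ∸ s b) ℕ.!≢0}})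

  Sᵃ-cong : ∀ {p} n (k : Fin p → ℕ) {s s′} → s ≗ s′ → Sᵃ n k s ≈ Sᵃ n k s′
  Sᵃ-cong {p} n k s≗s′ = *-cong
    (reflexive (≡.cong (λ t → δ (sumFin k ℕ.≤? n) * (- 1#) ^ (sumFin k ∸ t)
      * fromℕ (((n ∸ t) ! / (n ∸ sumFin k) !) {{(n ∸ sumFin k) ℕ.!≢0}})) (sumFin-cong s≗s′)))
    (∏-cong (allFin p) λ b → reflexive (≡.cong (λ t → fromℕ ((k b ! / (k b ∸ t) !) {{(k b ∸ t) ℕ.!≢0}})) (s≗s′ b)))

  -- Where `Sᵃ` relies on guards, `Φ` vanishes by itself: through `falling` if s ≤ k fails, through
  -- `_P′_` if |k| > n. In range, (n - |s|) - (|k| - |s|) = n - |k| identifies the quotients.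
  Φ≈Sᵃ : ∀ {p} n (k s : Fin p → ℕ) → sumFin s ℕ.≤ n →
    Φ k (n ∸ sumFin s) s ≈ δ (Fin.all? λ b → s b ℕ.≤? k b) * Sᵃ n k s
  Φ≈Sᵃ {p} n k s |s|≤n = go (Fin.all? λ b → s b ℕ.≤? k b)
    where
    sign   = (- 1#) ^ (sumFin k ∸ sumFin s)
    ratio  = fromℕ (((n ∸ sumFin s) ! / (n ∸ sumFin k) !) {{(n ∸ sumFin k) ℕ.!≢0}})
    ratios = ∏ (allFin p) λ b → fromℕ ((k b ! / (k b ∸ s b) !) {{(k b ∸ s b) ℕ.!≢0}})

    falling≈ : (∀ b → s b ℕ.≤ k b) → fromℕ (falling k s) ≈ ratios
    falling≈ s≤k = trans (fromℕ-prodFin (λ b → k b P′ s b))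
      (∏-cong (allFin p) λ b → reflexive (≡.cong fromℕ (nP′k≡n!/[n∸k]! (s≤k b))))

    sign*P′≈ : sumFin s ℕ.≤ sumFin k → (|k|≤?n : Dec (sumFin k ℕ.≤ n)) →
      sign * fromℕ ((n ∸ sumFin s) P′ (sumFin k ∸ sumFin s)) ≈ δ |k|≤?n * (sign * ratio)
    sign*P′≈ |s|≤|k| (yes |k|≤n) = trans (*-congˡ (reflexive (≡.cong fromℕ
      (≡.trans (nP′k≡n!/[n∸k]! (ℕ.∸-monoˡ-≤ (sumFin s) |k|≤n))
        (≡.cong (λ l → ((n ∸ sumFin s) ! / l !) {{l ℕ.!≢0}})
          (≡.trans (ℕ.∸-+-assoc n (sumFin s) _) (≡.cong (n ∸_) (ℕ.m+[n∸m]≡n |s|≤|k|)))))))) (sym (*-identityˡ _))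
    -- Since |s| ≤ n, subtracting |s| from n < |k| keeps the inequality strict.
    sign*P′≈ |s|≤|k| (no |k|≰n) = trans
      (trans (*-congˡ (reflexive (≡.cong fromℕ (P′-vanishes (ℕ.∸-monoˡ-< (ℕ.≰⇒> |k|≰n) |s|≤n))))) (zeroʳ _))
      (sym (zeroˡ _))

    go : (s≤?k : Dec (∀ b → s b ℕ.≤ k b)) → Φ k (n ∸ sumFin s) s ≈ δ s≤?k * Sᵃ n k s
    go (no s≰k) with b , sb≰kb ← Fin.¬∀⟶∃¬ p _ (λ b → s b ℕ.≤? k b) s≰k =
      trans (Φ-vanishes k (n ∸ sumFin s) s (falling-vanishes k s b (ℕ.≰⇒> sb≰kb))) (sym (zeroˡ _))
    go (yes s≤k) = trans
      (*-cong (trans (sign*P′≈ (sumFin-mono s≤k) (sumFin k ℕ.≤? n)) (sym (*-assoc _ _ _))) (falling≈ s≤k))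
      (sym (*-identityˡ _))

-- Regrouping the coordinate list by blocks.

foldr-concatMap : ∀ {A B : Set} {c} {C : Set c} (f : B → C → C) (z : C) (h : A → List B) xs →
  foldr f z (concatMap h xs) ≡ foldr (λ x z′ → foldr f z′ (h x)) z xs
foldr-concatMap f z h []       = ≡.refl
foldr-concatMap f z h (x ∷ xs) =
  ≡.trans (List.foldr-++ f z (h x) _) (≡.cong (λ z′ → foldr f z′ (h x)) (foldr-concatMap f z h xs))

product-concatMap : ∀ {A B : Set} (f : B → ℕ) (h : A → List B) xs →
  ℕ.product (map f (concatMap h xs)) ≡ ℕ.product (map (λ x → ℕ.product (map f (h x))) xs)
product-concatMap f h []       = ≡.refl
product-concatMap f h (x ∷ xs) = begin
  ℕ.product (map f (h x ++ concatMap h xs))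
    ≡⟨ ≡.cong ℕ.product (List.map-++ f (h x) _) ⟩
  ℕ.product (map f (h x) ++ map f (concatMap h xs))
    ≡⟨ ℕ.product-++ (map f (h x)) _ ⟩
  ℕ.product (map f (h x)) ℕ.* ℕ.product (map f (concatMap h xs))
    ≡⟨ ≡.cong (ℕ.product (map f (h x)) ℕ.*_) (product-concatMap f h xs) ⟩
  ℕ.product (map f (h x)) ℕ.* ℕ.product (map (λ x → ℕ.product (map f (h x))) xs) ∎
  where open ≡-Reasoning

-- Through tuples, the value of `eval` depends only on the values of a syndrome, without function
-- extensionality.
tuple-cong : ∀ {m} {F : Fin m → Set} {f g : ∀ i → F i} → (∀ i → f i ≡ g i) → tuple f ≡ tuple g
tuple-cong {zero}  f≗g = ≡.refl
tuple-cong {suc m} f≗g = ≡.cong₂ _,_ (f≗g zero) (tuple-cong (f≗g ∘ suc))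

-- The operators `∂^ k` at w = 0.

module NoiseDerivatives {c ℓ} (R : CommutativeRing c ℓ) {r : ℕ} (n p : Fin r → ℕ) where
  open CommutativeRing R hiding (zero)
  open RingOps R
  open FiniteSums R
  open Polynomial R hiding (refl; sym; trans)
  open Syndromes n p
  open Noise R n p
  open Derivatives R _≟ᶜ_
  open BlockWeights R
  open SetoidReasoning setoid
  open SemiringSolver commutativeSemiring using (solve; _:*_; _:=_)
  open CommutativeSemigroupProperties *-commutativeSemigroup using (x∙yz≈y∙xz)
  private
    module P  = CommutativeRing (polyRing Coord)
    module PP = RingProperties P.ring
    module PO = RingOps (polyRing Coord)
    module PF = FiniteSums (polyRing Coord)
    module RO = Operators R
    module X  = RingOps (polyRing XVar)
  open Operators (polyRing Coord) using (·-*ˡ; compose; compose≡foldr; composeAdditive; compose-Leibniz; compose-*ˡ; compose-∏)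

  private
    at0-additive : Additive (polyRing Coord) R at0
    at0-additive = ⟦⟧-additive (λ _ → 0#)
    module at0 = Additive at0-additive

  Dᵃ : (a : Fin r) → (Fin (p a) → ℕ) → WPoly → WPoly
  Dᵃ a = D (a ,_)

  Dᵃ-additive : ∀ a k → Additive (polyRing Coord) (polyRing Coord) (Dᵃ a k)
  Dᵃ-additive a = D-additive (a ,_)

  -- `coords` lists the blocks one after another, so the single fold is already a composition over
  -- blocks of compositions over coordinates, in the same order.
  ∂^≡compose : ∀ k P → ∂^ k P ≡ compose (λ a → Dᵃ a (k a)) P
  ∂^≡compose k P = ≡.trans
    (foldr-concatMap step P (λ a → map (a ,_) (allFin (p a))) (allFin r))
    (≡.trans
      (List.foldr-cong (λ a T → ≡.trans (List.foldr-map step (a ,_) T (allFin (p a)))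
        (≡.sym (compose≡foldr (λ b → step (a , b)) T))) ≡.refl (allFin r))
      (≡.sym (compose≡foldr (λ a → Dᵃ a (k a)) P)))
    where
    step : Coord → WPoly → WPoly
    step (a , b) T = iterate (∂ _≟ᶜ_ (a , b)) T (k a b)

  ∂₀ : MultiIndex → WPoly → Carrier
  ∂₀ k P = at0 (∂^ k P)

  ∂₀≈compose : ∀ k P → ∂₀ k P ≈ at0 (compose (λ a → Dᵃ a (k a)) P)
  ∂₀≈compose k P = reflexive (≡.cong at0 (∂^≡compose k P))

  ∂₀-additive : ∀ k → Additive (polyRing Coord) R (∂₀ k)
  ∂₀-additive k = record
    { cong   = λ {P} {Q} P≈Q → trans (∂₀≈compose k P) (trans (at0.cong (E.cong P≈Q)) (sym (∂₀≈compose k Q)))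
    ; +-homo = λ P Q → trans (∂₀≈compose k (P ⊕ Q)) (trans (at0.cong (E.+-homo P Q))
        (+-cong (sym (∂₀≈compose k P)) (sym (∂₀≈compose k Q))))
    ; 0-homo = trans (∂₀≈compose k (con 0#)) (at0.cong E.0-homo)
    }
    where module E = Additive (composeAdditive λ a → Dᵃ-additive a (k a))

  ∂₀-con-* : ∀ k x P → ∂₀ k (con x ⊗ P) ≈ x * ∂₀ k P
  ∂₀-con-* k x P = trans (∂₀≈compose k (con x ⊗ P)) (trans
    (at0.cong (compose-*ˡ (λ a → Dᵃ-additive a (k a)) (λ a → D-*ˡ (a ,_) (k a) (λ _ → P.refl)) P))
    (*-congˡ (sym (∂₀≈compose k P))))

  Cf≡prodFin : ∀ i j → Cf i j ≡ prodFin λ a → prodFin λ b → (i a b ℕ.+ j a b) C i a b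
  Cf≡prodFin i j = ≡.trans
    (product-concatMap (λ (a , b) → (i a b ℕ.+ j a b) C i a b) (λ a → map (a ,_) (allFin (p a))) (allFin r))
    (prodFin-cong λ a → ≡.cong ℕ.product (≡.sym (List.map-∘ (allFin (p a)))))

  fromℕ-binomialIf : ∀ k i j → fromℕ (binomialIf k i j) ≈ δ (i ℕ.+ j ℕ.≟ k) * fromℕ ((i ℕ.+ j) C i)
  fromℕ-binomialIf k i j with does (i ℕ.+ j ℕ.≟ k)
  ... | true  = sym (*-identityˡ _)
  ... | false = sym (zeroˡ _)

  fromℕ-prodFin₂ : ∀ (v : MultiIndex) →
    fromℕ (prodFin λ a → prodFin (v a)) ≈ ∏ (allFin r) λ a → ∏ (allFin (p a)) λ b → fromℕ (v a b)
  fromℕ-prodFin₂ v = trans (fromℕ-prodFin λ a → prodFin (v a)) (∏-cong (allFin r) λ a → fromℕ-prodFin (v a))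

  δ-all?₂ : {Z : ∀ a → Fin (p a) → Set} (Z? : ∀ a b → Dec (Z a b)) →
    δ (Fin.all? λ a → Fin.all? (Z? a)) ≈ ∏ (allFin r) λ a → ∏ (allFin (p a)) λ b → δ (Z? a b)
  δ-all?₂ Z? = trans (δ-all? λ a → Fin.all? (Z? a)) (∏-cong (allFin r) λ a → δ-all? (Z? a))

  -- The coordinatewise conditions multiply to the single condition i + j = k, and the binomials to
  -- `Cf`.
  fromℕ-binomialsIf : ∀ k i j →
    fromℕ (prodFin λ a → prodFin λ b → binomialIf (k a b) (i a b) (j a b)) ≈ δ (i +ᵐ j ≐? k) * fromℕ (Cf i j)
  fromℕ-binomialsIf k i j = begin
    fromℕ (prodFin λ a → prodFin λ b → binomialIf (k a b) (i a b) (j a b))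
      ≈⟨ fromℕ-prodFin₂ (λ a b → binomialIf (k a b) (i a b) (j a b)) ⟩
    ∏ (allFin r) (λ a → ∏ (allFin (p a)) λ b → fromℕ (binomialIf (k a b) (i a b) (j a b)))
      ≈⟨ ∏-cong (allFin r) (λ a → trans (∏-cong (allFin (p a)) λ b → fromℕ-binomialIf (k a b) (i a b) (j a b)) (∏-* (allFin (p a)))) ⟩
    ∏ (allFin r) (λ a → ∏ (allFin (p a)) (λ b → δ (i a b ℕ.+ j a b ℕ.≟ k a b)) * ∏ (allFin (p a)) λ b → fromℕ ((i a b ℕ.+ j a b) C i a b))
      ≈⟨ ∏-* (allFin r) ⟩
    ∏ (allFin r) (λ a → ∏ (allFin (p a)) (λ b → δ (i a b ℕ.+ j a b ℕ.≟ k a b))) *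
    ∏ (allFin r) (λ a → ∏ (allFin (p a)) λ b → fromℕ ((i a b ℕ.+ j a b) C i a b))
      ≈⟨ *-cong
           (δ-all?₂ λ a b → (i +ᵐ j) a b ℕ.≟ k a b)
           (trans (reflexive (≡.cong fromℕ (Cf≡prodFin i j))) (fromℕ-prodFin₂ λ a b → (i a b ℕ.+ j a b) C i a b)) ⟨
    δ (i +ᵐ j ≐? k) * fromℕ (Cf i j) ∎

  ∂₀-* : ∀ k P Q → ∂₀ k (P ⊗ Q) ≈
    ∑ (below k) λ i → ∑ (below k) λ j → δ (i +ᵐ j ≐? k) * (fromℕ (Cf i j) * (∂₀ i P * ∂₀ j Q))
  ∂₀-* k P Q = begin
    ∂₀ k (P ⊗ Q)
      ≈⟨ ∂₀≈compose k (P ⊗ Q) ⟩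
    at0 (compose (λ a → Dᵃ a (k a)) (P ⊗ Q))
      ≈⟨ at0.cong (compose-Leibniz {E = Dᵃ} {↓ = λ a k → functions λ b → upTo (suc (k b))}
           {w = λ a k i j → prodFin λ b → binomialIf (k b) (i b) (j b)} Dᵃ-additive (λ a → D-Leibniz (a ,_)) k P Q) ⟩
    at0 (PO.∑ (below k) λ i → PO.∑ (below k) λ j → w i j PO.· (compose (λ a → Dᵃ a (i a)) P ⊗ compose (λ a → Dᵃ a (j a)) Q))
      ≈⟨ trans (at0.∑-homo (below k)) (∑-cong (below k) λ i → trans (at0.∑-homo (below k)) (∑-cong (below k) λ j → at0.·-homo (w i j) _)) ⟩
    ∑ (below k) (λ i → ∑ (below k) λ j → w i j · (at0 (compose (λ a → Dᵃ a (i a)) P) * at0 (compose (λ a → Dᵃ a (j a)) Q)))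
      ≈⟨ ∑-cong (below k) (λ i → ∑-cong (below k) λ j → trans (RO.·-*ˡ (w i j) _)
           (trans (*-cong (fromℕ-binomialsIf k i j) (*-cong (sym (∂₀≈compose i P)) (sym (∂₀≈compose j Q)))) (*-assoc _ _ _))) ⟩
    ∑ (below k) (λ i → ∑ (below k) λ j → δ (i +ᵐ j ≐? k) * (fromℕ (Cf i j) * (∂₀ i P * ∂₀ j Q))) ∎
    where
    w : MultiIndex → MultiIndex → ℕ
    w i j = prodFin λ a → prodFin λ b → binomialIf (k a b) (i a b) (j a b)

  -- Syndrome monomials, block by block.

  ∂-xToW-const : ∀ {a b j} → a ≢ j → ∀ v → ∂ᵥ (a , b) (xToW (j , v)) P.≈ P.0#
  ∂-xToW-const {a} {b} {j} a≢j zero    = P.trans (P.+-identityˡ _)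
    (P.trans (P.-‿cong (P.trans (Additive.∑-homo (∂-additive (a , b)) (allFin (p j)))
      (PF.∑-zero (allFin (p j)) λ b′ → ∂-var-≢ (a≢j ∘ ≡.cong proj₁)))) PP.-0#≈0#)
  ∂-xToW-const a≢j (suc b) = ∂-var-≢ (a≢j ∘ ≡.cong proj₁)

  monomialᵃ : ∀ a {m} → (Fin m → Fin (suc (p a))) → WPoly
  monomialᵃ a {m} γ = PO.∏ (allFin m) λ c → xToW (a , γ c)

  monomial : Syndrome → WPoly
  monomial γ = PO.∏ (allFin r) λ a → monomialᵃ a (γ a)

  at0-∏ : ∀ {A : Set} (xs : List A) (f : A → WPoly) → at0 (PO.∏ xs f) ≈ ∏ xs (at0 ∘ f)
  at0-∏ []       f = refl
  at0-∏ (x ∷ xs) f = *-congˡ (at0-∏ xs f)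

  ∂₀-monomial : ∀ k γ → ∂₀ k (monomial γ) ≈ ∏ (allFin r) λ a → at0 (Dᵃ a (k a) (monomialᵃ a (γ a)))
  ∂₀-monomial k γ = trans (∂₀≈compose k (monomial γ)) (trans
    (at0.cong (compose-∏ (λ a → Dᵃ-additive a (k a)) (λ a → monomialᵃ a (γ a))
      (λ i j i≢j → D-*ˡ (i ,_) (k i) (λ b → const i≢j b))
      (λ i j i≢j → D-*ʳ (i ,_) (k i) (λ b → D-const (j ,_) (k j) (const i≢j b)))))
    (at0-∏ (allFin r) _))
    where
    const : ∀ {i j} → i ≢ j → ∀ b → ∂ᵥ (i , b) (monomialᵃ j (γ j)) P.≈ P.0#
    const {j = j} i≢j b = ∂-∏-const _ (allFin (n j)) (λ c → ∂-xToW-const i≢j (γ j c))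

  -- `0 P′ l` is 1 for l = 0 and 0 otherwise; this form of the case distinction is the one that
  -- occurs in `Φ` for m = 0.
  D-1 : ∀ {m} (v : Fin m → Coord) k → D v k P.1# P.≈ PO.fromℕ (0 P′ sumFin k)
  D-1 {zero}  v k = P.sym (P.+-identityʳ P.1#)
  D-1 {suc m} v k = P.trans (Additive.cong (∂ⁿ-additive (v zero) (k zero)) (D-1 (v ∘ suc) (k ∘ suc)))
    (P.trans (go (k zero)) (P.reflexive (≡.cong (λ l → PO.fromℕ (0 P′ l)) (≡.sym (sumFin-suc k)))))
    where
    x = 0 P′ sumFin (k ∘ suc)
    go : ∀ l → iterate (∂ᵥ (v zero)) (PO.fromℕ x) l P.≈ PO.fromℕ (0 P′ (l ℕ.+ sumFin (k ∘ suc)))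
    go zero    = P.refl
    go (suc l) = P.trans
      (P.trans (Additive.cong (∂ⁿ-additive (v zero) l) (P.trans (Additive.·-homo (∂-additive (v zero)) x P.1#) (P.trans (·-*ˡ x P.0#) (P.zeroʳ _))))
        (Additive.0-homo (∂ⁿ-additive (v zero) l)))
      (P.reflexive (≡.cong PO.fromℕ (≡.sym (P′-vanishes {0} {suc (l ℕ.+ sumFin (k ∘ suc))} ℕ.z<s))))

  module _ (a : Fin r) where

    -- At w = 0 an undifferentiated factor w_b vanishes, so one of the `k b` derivatives has to act
    -- on it.
    at0-D-var-* : ∀ k b Q → at0 (Dᵃ a k (var (a , b) ⊗ Q)) ≈ fromℕ (k b) * at0 (Dᵃ a (updateAt k b pred) Q)
    at0-D-var-* k b Q = begin
      at0 (Dᵃ a k (var (a , b) ⊗ Q))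
        ≈⟨ at0.cong (D-var-* (a ,_) (λ { ≡.refl → ≡.refl }) k b Q) ⟩
      0# * at0 (Dᵃ a k Q) + at0 (k b PO.· Dᵃ a (updateAt k b pred) Q)
        ≈⟨ trans (+-congʳ (zeroˡ _)) (+-identityˡ _) ⟩
      at0 (k b PO.· Dᵃ a (updateAt k b pred) Q)
        ≈⟨ trans (at0.·-homo (k b) _) (RO.·-*ˡ (k b) _) ⟩
      fromℕ (k b) * at0 (Dᵃ a (updateAt k b pred) Q) ∎

    at0-Dᵃ-1 : ∀ k → at0 (Dᵃ a k (con 1#)) ≈ Φ k 0 (λ _ → 0)
    at0-Dᵃ-1 k = begin
      at0 (Dᵃ a k (con 1#))
        ≈⟨ trans (at0.cong (D-1 (a ,_) k)) (at0.·-homo (0 P′ sumFin k) (con 1#)) ⟩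
      fromℕ (0 P′ sumFin k)
        ≈⟨ sign (sumFin k) ⟩
      (- 1#) ^ sumFin k * fromℕ (0 P′ sumFin k)
        ≈⟨ trans (*-congˡ (trans (fromℕ-prodFin {p a} (λ _ → 1)) ones)) (*-identityʳ _) ⟨
      (- 1#) ^ sumFin k * fromℕ (0 P′ sumFin k) * fromℕ (falling k (λ _ → 0))
        ≡⟨ ≡.cong (λ l → (- 1#) ^ (sumFin k ∸ l) * fromℕ (0 P′ (sumFin k ∸ l)) * fromℕ (falling k (λ _ → 0))) (sumFin-0 {p a}) ⟨
      Φ k 0 (λ _ → 0) ∎
      where
      ones : ∏ (allFin (p a)) (λ _ → fromℕ 1) ≈ 1#
      ones = trans (∏-cong (allFin (p a)) (λ _ → +-identityʳ 1#)) (∏-1 (allFin (p a)))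
      -- A sign may be inserted because the number is zero whenever l > 0.
      sign : ∀ l → fromℕ (0 P′ l) ≈ (- 1#) ^ l * fromℕ (0 P′ l)
      sign zero    = sym (*-identityˡ _)
      sign (suc l) = trans vanish (sym (trans (*-congˡ vanish) (zeroʳ _)))
        where
        vanish : fromℕ (0 P′ suc l) ≈ 0#
        vanish = reflexive (≡.cong fromℕ (P′-vanishes {0} {suc l} ℕ.z<s))

    at0-Dᵃ-x₀-* : ∀ k Q → at0 (Dᵃ a k (xToW (a , zero) ⊗ Q)) ≈
      at0 (Dᵃ a k Q) + - ∑ (allFin (p a)) λ b → fromℕ (k b) * at0 (Dᵃ a (updateAt k b pred) Q)
    at0-Dᵃ-x₀-* k Q = begin
      at0 (Dᵃ a k (xToW (a , zero) ⊗ Q))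
        ≈⟨ at0.cong (E.cong (P.trans (P.distribʳ Q _ _)
             (P.+-cong (P.*-identityˡ Q) (P.trans (P.sym (PP.-‿distribˡ-* _ Q)) (P.-‿cong (PF.∑-*ʳ (allFin (p a)) Q)))))) ⟩
      at0 (Dᵃ a k (Q ⊕ ⊖ PO.∑ (allFin (p a)) λ b → var (a , b) ⊗ Q))
        ≈⟨ at0.cong (P.trans (E.+-homo _ _) (P.+-congˡ (E.-‿homo _))) ⟩
      at0 (Dᵃ a k Q) + - at0 (Dᵃ a k (PO.∑ (allFin (p a)) λ b → var (a , b) ⊗ Q))
        ≈⟨ +-congˡ (-‿cong (trans (at0.cong (E.∑-homo (allFin (p a)))) (trans (at0.∑-homo (allFin (p a)))
             (∑-cong (allFin (p a)) λ b → at0-D-var-* k b Q)))) ⟩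
      at0 (Dᵃ a k Q) + - ∑ (allFin (p a)) (λ b → fromℕ (k b) * at0 (Dᵃ a (updateAt k b pred) Q)) ∎
      where module E = Additive (Dᵃ-additive a k)

    -- Induction on the number of factors, for all k at once, because removing a factor also calls
    -- for `updateAt k b pred`. Either kind of factor obeys the corresponding recursion of `Φ`.
    at0-Dᵃ-monomialᵃ : ∀ {m} (γ : Fin m → Fin (suc (p a))) k →
      at0 (Dᵃ a k (monomialᵃ a γ)) ≈ Φ k (m ∸ sumFin (count γ)) (count γ)
    at0-Dᵃ-monomialᵃ {zero}  γ k = trans (at0-Dᵃ-1 k)
      (reflexive (≡.cong (λ m → Φ k m (λ _ → 0)) (≡.sym (ℕ.0∸n≡0 (sumFin {p a} λ _ → 0)))))
    at0-Dᵃ-monomialᵃ {suc m} γ k = trans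
      (at0.cong (Additive.cong (Dᵃ-additive a k) (PF.∏-allFin-suc λ c → xToW (a , γ c)))) (go (γ zero) ≡.refl)
      where
      γ₊ = γ ∘ suc
      m₊ = m ∸ sumFin (count γ₊)
      go : ∀ v → γ zero ≡ v →
        at0 (Dᵃ a k (xToW (a , γ zero) ⊗ monomialᵃ a γ₊)) ≈ Φ k (suc m ∸ sumFin (count γ)) (count γ)
      go zero e = begin
        at0 (Dᵃ a k (xToW (a , γ zero) ⊗ monomialᵃ a γ₊))
          ≡⟨ ≡.cong (λ v → at0 (Dᵃ a k (xToW (a , v) ⊗ monomialᵃ a γ₊))) e ⟩
        at0 (Dᵃ a k (xToW (a , zero) ⊗ monomialᵃ a γ₊))
          ≈⟨ at0-Dᵃ-x₀-* k (monomialᵃ a γ₊) ⟩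
        at0 (Dᵃ a k (monomialᵃ a γ₊)) + - ∑ (allFin (p a)) (λ b → fromℕ (k b) * at0 (Dᵃ a (updateAt k b pred) (monomialᵃ a γ₊)))
          -- `Φ-suc-var`, read backwards, turns lowering k into raising the weight, which is the
          -- form that `Φ-suc-zero` expects.
          ≈⟨ +-cong (at0-Dᵃ-monomialᵃ γ₊ k) (-‿cong (∑-cong (allFin (p a)) λ b →
               trans (*-congˡ (at0-Dᵃ-monomialᵃ γ₊ (updateAt k b pred))) (sym (Φ-suc-var k m₊ (count γ₊) b)))) ⟩
        Φ k m₊ (count γ₊) + - ∑ (allFin (p a)) (λ b → Φ k m₊ (updateAt (count γ₊) b suc))
          ≈⟨ Φ-suc-zero k m₊ (count γ₊) ⟨
        Φ k (suc m₊) (count γ₊)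
          -- A zero entry keeps the weight and raises the exponent of the factor 1 - ∑ w_b by one.
          ≡⟨ ≡.cong (λ l → Φ k l (count γ₊)) (≡.trans (≡.sym (ℕ.+-∸-assoc 1 (sum-count≤ γ₊)))
               (≡.cong (suc m ∸_) (≡.sym (sumFin-cong (count-zero γ e))))) ⟩
        Φ k (suc m ∸ sumFin (count γ)) (count γ₊)
          ≈⟨ Φ-cong k (suc m ∸ sumFin (count γ)) (count-zero γ e) ⟨
        Φ k (suc m ∸ sumFin (count γ)) (count γ) ∎
      go (suc b) e = begin
        at0 (Dᵃ a k (xToW (a , γ zero) ⊗ monomialᵃ a γ₊))
          ≡⟨ ≡.cong (λ v → at0 (Dᵃ a k (xToW (a , v) ⊗ monomialᵃ a γ₊))) e ⟩
        at0 (Dᵃ a k (var (a , b) ⊗ monomialᵃ a γ₊))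
          ≈⟨ at0-D-var-* k b (monomialᵃ a γ₊) ⟩
        fromℕ (k b) * at0 (Dᵃ a (updateAt k b pred) (monomialᵃ a γ₊))
          ≈⟨ *-congˡ (at0-Dᵃ-monomialᵃ γ₊ (updateAt k b pred)) ⟩
        fromℕ (k b) * Φ (updateAt k b pred) m₊ (count γ₊)
          ≈⟨ Φ-suc-var k m₊ (count γ₊) b ⟨
        Φ k m₊ (updateAt (count γ₊) b suc)
          -- A nonzero entry raises both the length and the weight by one, leaving the exponent of 1
          -- - ∑ w_b unchanged.
          ≡⟨ ≡.cong (λ l → Φ k (suc m ∸ l) (updateAt (count γ₊) b suc)) (sum-count-suc γ e) ⟨
        Φ k (suc m ∸ sumFin (count γ)) (updateAt (count γ₊) b suc)
          ≈⟨ Φ-cong k (suc m ∸ sumFin (count γ)) (count-suc γ e) ⟨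
        Φ k (suc m ∸ sumFin (count γ)) (count γ) ∎

  infix 4 _≤ᵐ?_
  _≤ᵐ?_ : ∀ (s k : MultiIndex) → Dec (∀ a b → s a b ℕ.≤ k a b)
  s ≤ᵐ? k = Fin.all? λ a → Fin.all? λ b → s a b ℕ.≤? k a b

  ∂₀-monomial≈S : ∀ k γ → ∂₀ k (monomial γ) ≈ δ (wt γ ≤ᵐ? k) * S k (wt γ)
  ∂₀-monomial≈S k γ = begin
    ∂₀ k (monomial γ)
      ≈⟨ ∂₀-monomial k γ ⟩
    ∏ (allFin r) (λ a → at0 (Dᵃ a (k a) (monomialᵃ a (γ a))))
      ≈⟨ ∏-cong (allFin r) (λ a → trans (at0-Dᵃ-monomialᵃ a (γ a) (k a)) (Φ≈Sᵃ (n a) (k a) (wt γ a) (sum-count≤ (γ a)))) ⟩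
    ∏ (allFin r) (λ a → δ (Fin.all? λ b → wt γ a b ℕ.≤? k a b) * Sᵃ (n a) (k a) (wt γ a))
      ≈⟨ ∏-* (allFin r) ⟩
    ∏ (allFin r) (λ a → δ (Fin.all? λ b → wt γ a b ℕ.≤? k a b)) * ∏ (allFin r) (λ a → Sᵃ (n a) (k a) (wt γ a))
      ≈⟨ *-congʳ (δ-all? λ a → Fin.all? λ b → wt γ a b ℕ.≤? k a b) ⟨
    δ (wt γ ≤ᵐ? k) * S k (wt γ) ∎

  -- Summing over syndromes and collecting them by weight.

  substitute-∑ : ∀ {A : Set} (xs : List A) {f : A → Poly XVar} {h : A → WPoly} →
    (∀ x → substitute xToW (f x) ≡ h x) → substitute xToW (X.∑ xs f) ≡ PO.∑ xs h
  substitute-∑ []       f≗h = ≡.refl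
  substitute-∑ (x ∷ xs) f≗h = ≡.cong₂ _⊕_ (f≗h x) (substitute-∑ xs f≗h)

  substitute-∏ : ∀ {A : Set} (xs : List A) {f : A → Poly XVar} {h : A → WPoly} →
    (∀ x → substitute xToW (f x) ≡ h x) → substitute xToW (X.∏ xs f) ≡ PO.∏ xs h
  substitute-∏ []       f≗h = ≡.refl
  substitute-∏ (x ∷ xs) f≗h = ≡.cong₂ _⊗_ (f≗h x) (substitute-∏ xs f≗h)

  substitute-δ : ∀ {Z : Set} (Z? : Dec Z) → substitute xToW (X.δ Z?) ≡ con (δ Z?)
  substitute-δ Z? with does Z?
  ... | true  = ≡.refl
  ... | false = ≡.refl

  ∑-elements-δ : ∀ {Q : Set} (finQ : Finite Q) e → ∑ (elements finQ) (λ τ → δ (finite-≟ finQ τ e)) ≈ 1#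
  ∑-elements-δ finQ@(m , Q↔Fin) e = begin
    ∑ (elements finQ) (λ τ → δ (finite-≟ finQ τ e))
      ≈⟨ ∑-map from (allFin m) ⟩
    ∑ (allFin m) (λ i → δ (finite-≟ finQ (from i) e))
      ≈⟨ ∑-cong (allFin m) (λ i → δ-cong (finite-≟ finQ (from i) e) (to e Fin.≟ i)
           (λ { ≡.refl → strictlyInverseˡ i }) (λ { ≡.refl → strictlyInverseʳ e })) ⟩
    ∑ (allFin m) (λ i → δ (to e Fin.≟ i))
      ≈⟨ ∑-allFin-δ (to e) ⟩
    1# ∎
    where open Inverse Q↔Fin

  -- `below` enumerates choice functions and `≐` is a conjunction over coordinates, so the count of
  -- t in the box is the product of its counts in the intervals.
  ∑-below-δ : ∀ k t → ∑ (below k) (λ s → δ (t ≐? s)) ≈ δ (t ≤ᵐ? k)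
  ∑-below-δ k t = begin
    ∑ (below k) (λ s → δ (t ≐? s))
      ≈⟨ ∑-cong (below k) (λ s → δ-all? λ a → Fin.all? λ b → t a b ℕ.≟ s a b) ⟩
    ∑ (below k) (λ s → ∏ (allFin r) λ a → δ (Fin.all? λ b → t a b ℕ.≟ s a b))
      ≈⟨ ∑-functions-∏ (λ a → functions λ b → upTo (suc (k a b))) (λ a s → δ (Fin.all? λ b → t a b ℕ.≟ s b)) ⟩
    ∏ (allFin r) (λ a → ∑ (functions λ b → upTo (suc (k a b))) λ s → δ (Fin.all? λ b → t a b ℕ.≟ s b))
      ≈⟨ ∏-cong (allFin r) (λ a → trans
           (∑-cong (functions λ b → upTo (suc (k a b))) λ s → δ-all? λ b → t a b ℕ.≟ s b)
           (∑-functions-∏ (λ b → upTo (suc (k a b))) (λ b i → δ (t a b ℕ.≟ i)))) ⟩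
    ∏ (allFin r) (λ a → ∏ (allFin (p a)) λ b → ∑ (upTo (suc (k a b))) λ i → δ (t a b ℕ.≟ i))
      ≈⟨ ∏-cong (allFin r) (λ a → ∏-cong (allFin (p a)) λ b → trans (∑-upTo-δ (suc (k a b)) (t a b))
           (δ-cong (t a b ℕ.<? suc (k a b)) (t a b ℕ.≤? k a b) ℕ.s≤s⁻¹ ℕ.s≤s)) ⟩
    ∏ (allFin r) (λ a → ∏ (allFin (p a)) λ b → δ (t a b ℕ.≤? k a b))
      ≈⟨ δ-all?₂ (λ a b → t a b ℕ.≤? k a b) ⟨
    δ (t ≤ᵐ? k) ∎

  -- The list need not contain t itself but only a pointwise equal copy, hence the condition that h
  -- respects `≐`.
  ∑-below-select : ∀ k t {h : MultiIndex → Carrier} → (∀ s → t ≐ s → h s ≈ h t) →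
    ∑ (below k) (λ s → δ (t ≐? s) * h s) ≈ δ (t ≤ᵐ? k) * h t
  ∑-below-select k t {h} h-resp = begin
    ∑ (below k) (λ s → δ (t ≐? s) * h s)    ≈⟨ ∑-cong (below k) (λ s → δ-*-congˡ (t ≐? s) (h-resp s)) ⟩
    ∑ (below k) (λ s → δ (t ≐? s) * h t)    ≈⟨ ∑-*ʳ (below k) (h t) ⟨
    ∑ (below k) (λ s → δ (t ≐? s)) * h t    ≈⟨ *-congʳ (∑-below-δ k t) ⟩
    δ (t ≤ᵐ? k) * h t                       ∎

  S-cong : ∀ k {s t} → s ≐ t → S k s ≈ S k t
  S-cong k s≐t = ∏-cong (allFin r) λ a → Sᵃ-cong (n a) (k a) (s≐t a)

  eval-wt-𝟎 : ∀ {Q : Set} (π : Word → Q) γ → wt γ ≐ 𝟎 → eval π γ ≡ π zeroWord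
  eval-wt-𝟎 π γ wt≐𝟎 = ≡.cong π (tuple-cong λ a → ≡.trans
    (Vec.tabulate-cong λ c → ≡.trans (count≡0⇒zero (γ a) (wt≐𝟎 a) c) (≡.sym (Vec.lookup-replicate c zero)))
    (Vec.tabulate∘lookup (Vec.replicate (n a) zero)))

  module _ {Q : Set} (finQ : Finite Q) where
    private
      _≟_ = finite-≟ finQ

    ∂₀-fʷ : ∀ k π τ → ∂₀ k (fʷ finQ π τ) ≈ ∑ syndromes λ γ → δ (τ ≟ eval π γ) * ∂₀ k (monomial γ)
    ∂₀-fʷ k π τ = begin
      ∂₀ k (fʷ finQ π τ)
        ≡⟨ ≡.cong (∂₀ k) (substitute-∑ syndromes λ γ → ≡.cong₂ _⊗_ (substitute-δ (τ ≟ eval π γ))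
             (substitute-∏ (allFin r) λ a → substitute-∏ (allFin (n a)) λ c → ≡.refl)) ⟩
      ∂₀ k (PO.∑ syndromes λ γ → con (δ (τ ≟ eval π γ)) ⊗ monomial γ)
        ≈⟨ Additive.∑-homo (∂₀-additive k) syndromes ⟩
      ∑ syndromes (λ γ → ∂₀ k (con (δ (τ ≟ eval π γ)) ⊗ monomial γ))
        ≈⟨ ∑-cong syndromes (λ γ → ∂₀-con-* k _ (monomial γ)) ⟩
      ∑ syndromes (λ γ → δ (τ ≟ eval π γ) * ∂₀ k (monomial γ)) ∎

    module _ {I : Set} (y : I → Q) (π : I → Word → Q) where
      private
        error? : ∀ x γ → Dec (¬ eval (π x) γ ≡ y x)
        error? x γ = ¬? (eval (π x) γ ≟ y x)

      -- A syndrome contributes to f for exactly one τ, its own value; on that τ the restriction τ ≠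
      -- y(x) becomes the error condition on γ.
      ∂₀-g : ∀ k x → ∂₀ k (g finQ y π x) ≈ ∑ syndromes λ γ → δ (error? x γ) * (δ (wt γ ≤ᵐ? k) * S k (wt γ))
      ∂₀-g k x = begin
        ∂₀ k (g finQ y π x)
          ≈⟨ Additive.∑-homo (∂₀-additive k) (filter (λ τ → ¬? (τ ≟ y x)) (elements finQ)) ⟩
        ∑ (filter (λ τ → ¬? (τ ≟ y x)) (elements finQ)) (λ τ → ∂₀ k (fʷ finQ (π x) τ))
          ≈⟨ ∑-filter (λ τ → ¬? (τ ≟ y x)) (elements finQ) ⟩
        ∑ (elements finQ) (λ τ → δ (¬? (τ ≟ y x)) * ∂₀ k (fʷ finQ (π x) τ))
          ≈⟨ ∑-cong (elements finQ) (λ τ → trans (*-congˡ (∂₀-fʷ k (π x) τ)) (trans (∑-*ˡ _ syndromes) (∑-cong syndromes (λ γ → move τ γ)))) ⟩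
        ∑ (elements finQ) (λ τ → ∑ syndromes λ γ → δ (τ ≟ eval (π x) γ) * (δ (error? x γ) * ∂₀ k (monomial γ)))
          ≈⟨ ∑-swap (elements finQ) syndromes ⟩
        ∑ syndromes (λ γ → ∑ (elements finQ) λ τ → δ (τ ≟ eval (π x) γ) * (δ (error? x γ) * ∂₀ k (monomial γ)))
          ≈⟨ ∑-cong syndromes (λ γ → trans (sym (∑-*ʳ (elements finQ) _))
               (trans (*-congʳ (∑-elements-δ finQ (eval (π x) γ))) (*-identityˡ _))) ⟩
        ∑ syndromes (λ γ → δ (error? x γ) * ∂₀ k (monomial γ))
          ≈⟨ ∑-cong syndromes (λ γ → *-congˡ (∂₀-monomial≈S k γ)) ⟩
        ∑ syndromes (λ γ → δ (error? x γ) * (δ (wt γ ≤ᵐ? k) * S k (wt γ))) ∎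
        where
        move : ∀ τ γ → δ (¬? (τ ≟ y x)) * (δ (τ ≟ eval (π x) γ) * ∂₀ k (monomial γ)) ≈
                       δ (τ ≟ eval (π x) γ) * (δ (error? x γ) * ∂₀ k (monomial γ))
        move τ γ = trans (x∙yz≈y∙xz _ _ _) (δ-*-congˡ (τ ≟ eval (π x) γ) λ { ≡.refl → refl })

      module _ (π-zero : ∀ x → π x zeroWord ≡ y x) where

        wt≐𝟎⇒noError : ∀ x γ → wt γ ≐ 𝟎 → ¬ ¬ eval (π x) γ ≡ y x
        wt≐𝟎⇒noError x γ wt≐𝟎 error = error (≡.trans (eval-wt-𝟎 (π x) γ wt≐𝟎) (π-zero x))

        ∂₀-g-𝟎 : ∀ {k} → k ≐ 𝟎 → ∀ x → ∂₀ k (g finQ y π x) ≈ 0#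
        ∂₀-g-𝟎 {k} k≐𝟎 x = trans (∂₀-g k x) (∑-zero syndromes λ γ → begin
          δ (error? x γ) * (δ (wt γ ≤ᵐ? k) * S k (wt γ))
            ≈⟨ δ-*-congˡ (error? x γ) (λ error → trans (*-congʳ (δ-no (wt γ ≤ᵐ? k) λ wt≤k →
                 wt≐𝟎⇒noError x γ (λ a b → ℕ.n≤0⇒n≡0 (≡.subst (wt γ a b ℕ.≤_) (k≐𝟎 a b) (wt≤k a b))) error)) (zeroˡ _)) ⟩
          δ (error? x γ) * 0#
            ≈⟨ zeroʳ _ ⟩
          0# ∎)

        ∂₀-g≈∑ : ∀ k x → ∂₀ k (g finQ y π x) ≈ ∑ (nonzeroBelow k) λ s → S k s * fromℕ (A finQ y π s x)
        ∂₀-g≈∑ k x = sym (begin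
          ∑ (nonzeroBelow k) (λ s → S k s * fromℕ (A finQ y π s x))
            ≈⟨ ∑-filter (λ s → ¬? (s ≐? 𝟎)) (below k) ⟩
          ∑ (below k) (λ s → δ (¬? (s ≐? 𝟎)) * (S k s * fromℕ (A finQ y π s x)))
            ≈⟨ ∑-cong (below k) (λ s → expand s) ⟩
          ∑ (below k) (λ s → ∑ syndromes λ γ → δ (error? x γ) * (δ (wt γ ≐? s) * h s))
            ≈⟨ ∑-swap (below k) syndromes ⟩
          ∑ syndromes (λ γ → ∑ (below k) λ s → δ (error? x γ) * (δ (wt γ ≐? s) * h s))
            ≈⟨ ∑-cong syndromes (λ γ → trans (sym (∑-*ˡ _ (below k))) (*-congˡ (∑-below-select k (wt γ) (h-resp (wt γ))))) ⟩
          ∑ syndromes (λ γ → δ (error? x γ) * (δ (wt γ ≤ᵐ? k) * h (wt γ)))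
            -- An erroneous syndrome has nonzero weight, so the condition hidden in `h` holds
            -- wherever the error factor is not zero.
            ≈⟨ ∑-cong syndromes (λ γ → δ-*-congˡ (error? x γ) λ error → *-congˡ (trans
                 (*-congʳ (δ-yes (¬? (wt γ ≐? 𝟎)) λ wt≐𝟎 → wt≐𝟎⇒noError x γ wt≐𝟎 error)) (*-identityˡ _))) ⟩
          ∑ syndromes (λ γ → δ (error? x γ) * (δ (wt γ ≤ᵐ? k) * S k (wt γ)))
            ≈⟨ ∂₀-g k x ⟨
          ∂₀ k (g finQ y π x) ∎)
          where
          -- The condition s ≠ 0 is moved into the summand, so that the selection can run over the
          -- whole box `below k`.
          h : MultiIndex → Carrier
          h s = δ (¬? (s ≐? 𝟎)) * S k s
          h-resp : ∀ t s → t ≐ s → h s ≈ h t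
          h-resp t s t≐s = *-cong (δ-cong (¬? (s ≐? 𝟎)) (¬? (t ≐? 𝟎))
            (λ s≢𝟎 t≐𝟎 → s≢𝟎 λ a b → ≡.trans (≡.sym (t≐s a b)) (t≐𝟎 a b))
            (λ t≢𝟎 s≐𝟎 → t≢𝟎 λ a b → ≡.trans (t≐s a b) (s≐𝟎 a b)))
            (S-cong k λ a b → ≡.sym (t≐s a b))
          expand : ∀ s → δ (¬? (s ≐? 𝟎)) * (S k s * fromℕ (A finQ y π s x)) ≈
            ∑ syndromes λ γ → δ (error? x γ) * (δ (wt γ ≐? s) * h s)
          expand s = begin
            δ (¬? (s ≐? 𝟎)) * (S k s * fromℕ (A finQ y π s x))
              ≈⟨ *-assoc _ _ _ ⟨
            h s * fromℕ (A finQ y π s x)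
              ≈⟨ *-congˡ (fromℕ-length-filter (λ γ → (wt γ ≐? s) ×-dec error? x γ) syndromes) ⟩
            h s * ∑ syndromes (λ γ → δ ((wt γ ≐? s) ×-dec error? x γ))
              ≈⟨ ∑-*ˡ (h s) syndromes ⟩
            ∑ syndromes (λ γ → h s * δ ((wt γ ≐? s) ×-dec error? x γ))
              ≈⟨ ∑-cong syndromes (λ γ → trans (*-congˡ (δ-× (wt γ ≐? s) (error? x γ)))
                   (solve 3 (λ u v w → u :* (v :* w) := w :* (v :* u)) refl (h s) (δ (wt γ ≐? s)) (δ (error? x γ)))) ⟩
            ∑ syndromes (λ γ → δ (error? x γ) * (δ (wt γ ≐? s) * h s)) ∎

        -- The square of g and the expectation over inputs.

        ∂₀-g² : ∀ k x → ∂₀ k (g finQ y π x PO.^ 2) ≈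
          ∑ (splittings k) λ (i , j) → fromℕ (Cf i j) * (∂₀ i (g finQ y π x) * ∂₀ j (g finQ y π x))
        ∂₀-g² k x = begin
          ∂₀ k (g finQ y π x PO.^ 2)
            ≈⟨ Additive.cong (∂₀-additive k) (P.*-congˡ (P.*-identityʳ _)) ⟩
          ∂₀ k (g finQ y π x ⊗ g finQ y π x)
            ≈⟨ ∂₀-* k (g finQ y π x) (g finQ y π x) ⟩
          ∑ (below k) (λ i → ∑ (below k) λ j → δ (i +ᵐ j ≐? k) * T i j)
            -- Terms with i = 0 or j = 0 are already zero, so both conditions can be inserted as
            -- factors; this produces the filters by which `splittings` is defined.
            ≈⟨ ∑-cong (below k) (λ i → ∑-cong (below k) λ j → sym (trans
                 (δ-*-absorb (¬? (i ≐? 𝟎)) λ ¬i≢𝟎 → vanishˡ (decidable-stable (i ≐? 𝟎) ¬i≢𝟎) j)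
                 (δ-*-absorb (¬? (j ≐? 𝟎)) λ ¬j≢𝟎 → vanishʳ i (decidable-stable (j ≐? 𝟎) ¬j≢𝟎)))) ⟩
          ∑ (below k) (λ i → ∑ (below k) λ j → δ (¬? (i ≐? 𝟎)) * (δ (¬? (j ≐? 𝟎)) * (δ (i +ᵐ j ≐? k) * T i j)))
            ≈⟨ ∑-cong (below k) (λ i → trans (sym (∑-*ˡ _ (below k))) (*-congˡ (sym (∑-filter (λ s → ¬? (s ≐? 𝟎)) (below k))))) ⟩
          ∑ (below k) (λ i → δ (¬? (i ≐? 𝟎)) * ∑ (nonzeroBelow k) λ j → δ (i +ᵐ j ≐? k) * T i j)
            ≈⟨ ∑-filter (λ s → ¬? (s ≐? 𝟎)) (below k) ⟨
          ∑ (nonzeroBelow k) (λ i → ∑ (nonzeroBelow k) λ j → δ (i +ᵐ j ≐? k) * T i j)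
            ≈⟨ ∑-cartesianProductWith _,_ (nonzeroBelow k) (nonzeroBelow k) ⟨
          ∑ (cartesianProduct (nonzeroBelow k) (nonzeroBelow k)) (λ (i , j) → δ (i +ᵐ j ≐? k) * T i j)
            ≈⟨ ∑-filter (λ (i , j) → i +ᵐ j ≐? k) (cartesianProduct (nonzeroBelow k) (nonzeroBelow k)) ⟨
          ∑ (splittings k) (λ (i , j) → T i j) ∎
          where
          T : MultiIndex → MultiIndex → Carrier
          T i j = fromℕ (Cf i j) * (∂₀ i (g finQ y π x) * ∂₀ j (g finQ y π x))
          vanishʳ : ∀ i {j} → j ≐ 𝟎 → δ (i +ᵐ j ≐? k) * T i j ≈ 0#
          vanishʳ i j≐𝟎 = trans (*-congˡ (trans (*-congˡ (trans (*-congˡ (∂₀-g-𝟎 j≐𝟎 x)) (zeroʳ _))) (zeroʳ _))) (zeroʳ _)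
          vanishˡ : ∀ {i} → i ≐ 𝟎 → ∀ j → δ (¬? (j ≐? 𝟎)) * (δ (i +ᵐ j ≐? k) * T i j) ≈ 0#
          vanishˡ i≐𝟎 j = trans (*-congˡ (trans (*-congˡ (trans (*-congˡ (trans (*-congʳ (∂₀-g-𝟎 i≐𝟎 x)) (zeroˡ _))) (zeroʳ _))) (zeroʳ _))) (zeroʳ _)

        -- The coefficients `Cf` and `S` and the ranges of s and t do not depend on x, so the sum
        -- over x moves innermost and becomes an expectation.
        ∂₀-H : ∀ (finI : Finite I) (q : I → Carrier) k → ∂₀ k (H finQ y π finI q) ≈
          ∑ (splittings k) λ (i , j) → ∑ (nonzeroBelow i) λ s → ∑ (nonzeroBelow j) λ t →
            fromℕ (Cf i j) * S i s * S j t
              * ∑ (elements finI) λ x → q x * (fromℕ (A finQ y π s x) * fromℕ (A finQ y π t x))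
        ∂₀-H finI q k = begin
          ∂₀ k (H finQ y π finI q)
            ≈⟨ Additive.∑-homo (∂₀-additive k) xs ⟩
          ∑ xs (λ x → ∂₀ k (con (q x) ⊗ g finQ y π x PO.^ 2))
            ≈⟨ ∑-cong xs (λ x → trans (∂₀-con-* k (q x) _) (trans (*-congˡ (∂₀-g² k x)) (∑-*ˡ (q x) (splittings k)))) ⟩
          ∑ xs (λ x → ∑ (splittings k) λ (i , j) → q x * (fromℕ (Cf i j) * (∂₀ i (g finQ y π x) * ∂₀ j (g finQ y π x))))
            ≈⟨ ∑-swap xs (splittings k) ⟩
          ∑ (splittings k) (λ (i , j) → ∑ xs λ x → q x * (fromℕ (Cf i j) * (∂₀ i (g finQ y π x) * ∂₀ j (g finQ y π x))))
            ≈⟨ ∑-cong (splittings k) (λ (i , j) → regroup i j) ⟩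
          ∑ (splittings k) (λ (i , j) → ∑ (nonzeroBelow i) λ s → ∑ (nonzeroBelow j) λ t →
            fromℕ (Cf i j) * S i s * S j t * ∑ xs λ x → q x * (α s x * α t x)) ∎
          where
          xs = elements finI
          α : MultiIndex → I → Carrier
          α s x = fromℕ (A finQ y π s x)
          regroup : ∀ i j → ∑ xs (λ x → q x * (fromℕ (Cf i j) * (∂₀ i (g finQ y π x) * ∂₀ j (g finQ y π x)))) ≈
            ∑ (nonzeroBelow i) λ s → ∑ (nonzeroBelow j) λ t → fromℕ (Cf i j) * S i s * S j t * ∑ xs λ x → q x * (α s x * α t x)
          regroup i j = begin
            ∑ xs (λ x → q x * (fromℕ (Cf i j) * (∂₀ i (g finQ y π x) * ∂₀ j (g finQ y π x))))
              ≈⟨ ∑-cong xs (λ x → begin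
                   q x * (fromℕ (Cf i j) * (∂₀ i (g finQ y π x) * ∂₀ j (g finQ y π x)))
                     ≈⟨ *-congˡ (*-congˡ (*-cong (∂₀-g≈∑ i x) (∂₀-g≈∑ j x))) ⟩
                   q x * (fromℕ (Cf i j) * (∑ N₁ (λ s → S i s * α s x) * ∑ N₂ (λ t → S j t * α t x)))
                     ≈⟨ *-assoc _ _ _ ⟨
                   q x * fromℕ (Cf i j) * (∑ N₁ (λ s → S i s * α s x) * ∑ N₂ (λ t → S j t * α t x))
                     ≈⟨ *-congˡ (trans (∑-*ʳ N₁ _) (∑-cong N₁ λ s → ∑-*ˡ _ N₂)) ⟩
                   q x * fromℕ (Cf i j) * ∑ N₁ (λ s → ∑ N₂ λ t → S i s * α s x * (S j t * α t x))
                     ≈⟨ trans (∑-*ˡ _ N₁) (∑-cong N₁ λ s → ∑-*ˡ _ N₂) ⟩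
                   ∑ N₁ (λ s → ∑ N₂ λ t → q x * fromℕ (Cf i j) * (S i s * α s x * (S j t * α t x)))
                     ≈⟨ ∑-cong N₁ (λ s → ∑-cong N₂ λ t →
                          solve 6 (λ q c u v a b → q :* c :* (u :* a :* (v :* b)) := c :* u :* v :* (q :* (a :* b))) refl
                            (q x) (fromℕ (Cf i j)) (S i s) (S j t) (α s x) (α t x)) ⟩
                   ∑ N₁ (λ s → ∑ N₂ λ t → fromℕ (Cf i j) * S i s * S j t * (q x * (α s x * α t x))) ∎) ⟩
            ∑ xs (λ x → ∑ N₁ λ s → ∑ N₂ λ t → fromℕ (Cf i j) * S i s * S j t * (q x * (α s x * α t x)))
              ≈⟨ trans (∑-swap xs N₁) (∑-cong N₁ λ s → ∑-swap xs N₂) ⟩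
            ∑ N₁ (λ s → ∑ N₂ λ t → ∑ xs λ x → fromℕ (Cf i j) * S i s * S j t * (q x * (α s x * α t x)))
              ≈⟨ ∑-cong N₁ (λ s → ∑-cong N₂ λ t → ∑-*ˡ _ xs) ⟨
            ∑ N₁ (λ s → ∑ N₂ λ t → fromℕ (Cf i j) * S i s * S j t * ∑ xs λ x → q x * (α s x * α t x)) ∎
            where
            N₁ = nonzeroBelow i
            N₂ = nonzeroBelow j

mainTheorem7 : ∀ {c ℓ₁ ℓ₂} (K : OrderedCommutativeRing c ℓ₁ ℓ₂) →
    let open OrderedCommutativeRing K hiding (_≤_)
        open RingOps commutativeRing in
    (r : ℕ) (n p : Fin r → ℕ) →
    1 ≤ r → (∀ a → 1 ≤ n a) → (∀ a → 1 ≤ p a) →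
    let open Syndromes n p
        open Noise commutativeRing n p in
    (Q : Set) (finQ : Finite Q) (I : Set) (finI : Finite I) →
    let open Probability K finI in
    (q : I → Carrier) → IsDistribution q →
    (y : I → Q) (π : I → Word → Q) → (∀ x → π x zeroWord ≡ y x) →
    (k : MultiIndex) → 0 < ∣ k ∣ →
    at0 (∂^ k (H finQ y π finI q))
      ≈ ∑ (splittings k) λ (i , j) →
          ∑ (nonzeroBelow i) λ s →
            ∑ (nonzeroBelow j) λ t →
              fromℕ (Cf i j) * S i s * S j t
                * 𝔼 q (λ x → fromℕ (A finQ y π s x) * fromℕ (A finQ y π t x))
-- `𝔼 q` and `∂₀ k` unfold to the expressions on both sides, so the equation is the one already
-- derived.
mainTheorem7 K r n p _ _ _ Q finQ I finI q _ y π π-zero k _ =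
  NoiseDerivatives.∂₀-H (OrderedCommutativeRing.commutativeRing K) n p finQ y π π-zero finI q k
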